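{- Let $p=p(n)\in[0,1]$ satisfy $p\le 1-\frac{3\log n}{n}$. Then, with high probability, $\mathrm{tc}_2(G(n,n,p))\ge 3$.
   Context: $G(n,m,p)$ denotes the binomial random bipartite graph: its vertex classes are disjoint copies of $[n]$ and $[m]$, and each possible edge between the two classes appears independently with probability $p$. $\log$ is the natural logarithm. "With high probability" means with probability $1-o(1)$ as $n\to\infty$. A $2$-colouring of a graph $G$ is an arbitrary colouring of the edges of $G$ with up to $2$ colours. A monochromatic tree is a subgraph of $G$ that is a tree all of whose edges have the same colour (a single vertex counts as a monochromatic tree). $\mathrm{tc}_2(G)$ is the smallest integer $k$ such that, in every $2$-colouring of $G$, the vertex set $V(G)$ can be covered by at most $k$ monochromatic trees (not necessarily disjoint, and different trees may have different colours). -}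

module Defs where

open import Data.Bool.Base using (Bool; true; false; if_then_else_)
open import Data.Bool.Properties using () renaming (_≟_ to _≟ᵇ_)
open import Data.Empty using (⊥)
open import Data.Fin.Base using (Fin; zero; suc)
import Data.Fin.Properties as Fin
open import Data.Fin.Subset using (Subset; ⁅_⁆)
  renaming (_∈_ to _∈ˢ_; ⊥ to ∅)
open import Data.Fin.Subset.Properties using (x∈⁅x⁆; x∈⁅y⁆⇒x≡y; ∉⊥)
  renaming (_∈?_ to _∈ˢ?_)
open import Data.Integer.Base as ℤ using (+_; -[1+_])
import Data.Integer.Properties as ℤ
open import Data.List.Base as List
  using (List; []; _∷_; length; head; last; filter; cartesianProductWith; allFin)
open import Data.List.Membership.Propositional using (_∈_; lose)
open import Data.List.Membership.Propositional.Properties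
  using (∈-cartesianProductWith⁺; ∈-++⁺ˡ; ∈-++⁺ʳ; ∈-map⁺; ∈-allFin; ∈-lookup)
open import Data.List.Properties using (length-map)
open import Data.List.Relation.Unary.All as All using (All; []; _∷_)
open import Data.List.Relation.Unary.AllPairs using ([]; _∷_)
open import Data.List.Relation.Unary.Any as Any using (Any; here; there)
import Data.List.Relation.Unary.Any.Properties as Any
import Data.List.Relation.Unary.All.Properties as All
open import Data.List.Relation.Unary.Linked using (Linked; [-]; linked?)
open import Data.List.Relation.Unary.Unique.Propositional using (Unique)
import Data.List.Relation.Unary.Unique.DecPropositional as DecUnique
open import Data.Maybe.Base using (just)
import Data.Maybe.Properties as Maybe
open import Data.Nat.Base as ℕ using (ℕ; zero; suc; z≤n; s≤s)
import Data.Nat.Properties as ℕ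
open import Data.Nat.Tactic.RingSolver using (solve-∀)
open import Data.Product.Base using (∃; ∃-syntax; _×_; _,_; proj₁; proj₂)
open import Data.Rational.Base as ℚ using (ℚ; mkℚ; 0ℚ; 1ℚ; ∣_∣; toℚᵘ; *<*)
import Data.Rational.Properties as ℚ
open import Data.Rational.Solver using (module +-*-Solver)
open import Data.Rational.Unnormalised.Base as ℚᵘ using (mkℚᵘ; *≤*; *≡*)
import Data.Rational.Unnormalised.Properties as ℚᵘ
open import Data.Sum.Base using (_⊎_; inj₁; inj₂)
import Data.Sum.Properties as Sum
open import Data.Vec.Base as Vec using (Vec; []; _∷_)
import Data.Vec.Properties as Vec
open import Function.Base using (_∘_)
open import Relation.Binary.Definitions using (DecidableEquality)
import Relation.Binary.Definitions as Binary
open import Relation.Binary.PropositionalEquality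
  using (_≡_; refl; sym; trans; cong; cong₂; subst)
open import Relation.Nullary using (Dec; yes; no; ¬_; ¬?; _×-dec_; _→-dec_; contradiction)
open import Relation.Nullary.Decidable using (map′)
open import Relation.Unary using (Decidable)

-- Reals are Cauchy sequences of rationals.  Operations are pointwise;
-- x ≤ y holds when every ε > 0 eventually bounds the excess of x over y.

IsCauchy : (ℕ → ℚ) → Set
IsCauchy x = ∀ ε → 0ℚ ℚ.< ε →
  ∃[ N ] (∀ i j → N ℕ.≤ i → N ℕ.≤ j → ∣ x i ℚ.- x j ∣ ℚ.≤ ε)

record ℝ : Set where
  constructor mkℝ
  field
    seq    : ℕ → ℚ
    cauchy : IsCauchy seq

open ℝ public

module RealLemmas where
  ∣p∣≤ : ∀ {p r} → p ℚ.≤ r → ℚ.- p ℚ.≤ r → ∣ p ∣ ℚ.≤ r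
  ∣p∣≤ {p} p≤r -p≤r with ℚ.∣p∣≡p∨∣p∣≡-p p
  ... | inj₁ eq = subst (ℚ._≤ _) (sym eq) p≤r
  ... | inj₂ eq = subst (ℚ._≤ _) (sym eq) -p≤r

  half : ∀ ε → 0ℚ ℚ.< ε → ∃[ δ ] (0ℚ ℚ.< δ × δ ℚ.+ δ ≡ ε)
  half ε 0<ε = ℚ.½ ℚ.* ε
    , subst (ℚ._< ℚ.½ ℚ.* ε) (ℚ.*-zeroʳ ℚ.½) (ℚ.*-monoʳ-<-pos ℚ.½ 0<ε)
    , trans (sym (ℚ.*-distribʳ-+ ε ℚ.½ ℚ.½)) (ℚ.*-identityˡ ε)

  +-cauchy : ∀ x y → IsCauchy x → IsCauchy y → IsCauchy (λ k → x k ℚ.+ y k)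
  +-cauchy x y cx cy ε 0<ε with half ε 0<ε
  ... | δ , 0<δ , δ+δ≡ε with cx δ 0<δ | cy δ 0<δ
  ... | M , cx′ | N , cy′ = M ℕ.⊔ N , λ i j i≥ j≥ → let open ℚ.≤-Reasoning in begin
    ∣ (x i ℚ.+ y i) ℚ.- (x j ℚ.+ y j) ∣
      ≡⟨ cong ∣_∣ (solve 4 (λ a b c d → (a :+ b) :- (c :+ d) := (a :- c) :+ (b :- d))
                    refl (x i) (y i) (x j) (y j)) ⟩
    ∣ (x i ℚ.- x j) ℚ.+ (y i ℚ.- y j) ∣
      ≤⟨ ℚ.∣p+q∣≤∣p∣+∣q∣ (x i ℚ.- x j) (y i ℚ.- y j) ⟩
    ∣ x i ℚ.- x j ∣ ℚ.+ ∣ y i ℚ.- y j ∣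
      ≤⟨ ℚ.+-mono-≤ (cx′ i j (ℕ.m⊔n≤o⇒m≤o M N i≥) (ℕ.m⊔n≤o⇒m≤o M N j≥))
                    (cy′ i j (ℕ.m⊔n≤o⇒n≤o M N i≥) (ℕ.m⊔n≤o⇒n≤o M N j≥)) ⟩
    δ ℚ.+ δ ≡⟨ δ+δ≡ε ⟩
    ε ∎
    where open +-*-Solver

  neg-cauchy : ∀ x → IsCauchy x → IsCauchy (λ k → ℚ.- x k)
  neg-cauchy x cx ε 0<ε with cx ε 0<ε
  ... | N , cx′ = N , λ i j i≥ j≥ →
    subst (ℚ._≤ ε)
      (trans (sym (ℚ.∣-p∣≡∣p∣ (x i ℚ.- x j)))
        (cong ∣_∣ (solve 2 (λ a b → :- (a :- b) := (:- a) :- (:- b)) refl (x i) (x j))))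
      (cx′ i j i≥ j≥)
    where open +-*-Solver

  bounded : ∀ {x} → IsCauchy x →
    ∃[ B ] ∃[ N ] (ℚ.Positive B × (∀ i → N ℕ.≤ i → ∣ x i ∣ ℚ.≤ B))
  bounded {x} cx with cx 1ℚ (ℚ.positive⁻¹ 1ℚ)
  ... | N , cx′ = ∣ x N ∣ ℚ.+ 1ℚ , N
    , ℚ.nonNeg+pos⇒pos ∣ x N ∣ {{ℚ.∣-∣-nonNeg (x N)}} 1ℚ
    , λ i i≥ → let open ℚ.≤-Reasoning in begin
      ∣ x i ∣
        ≡⟨ cong ∣_∣ (solve 2 (λ a b → a := b :+ (a :- b)) refl (x i) (x N)) ⟩
      ∣ x N ℚ.+ (x i ℚ.- x N) ∣
        ≤⟨ ℚ.∣p+q∣≤∣p∣+∣q∣ (x N) (x i ℚ.- x N) ⟩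
      ∣ x N ∣ ℚ.+ ∣ x i ℚ.- x N ∣
        ≤⟨ ℚ.+-monoʳ-≤ ∣ x N ∣ (cx′ i N i≥ ℕ.≤-refl) ⟩
      ∣ x N ∣ ℚ.+ 1ℚ ∎
    where open +-*-Solver

  *-mono-∣∣ : ∀ p {q} r {s} → ℚ.Positive q → ∣ p ∣ ℚ.≤ q → ∣ r ∣ ℚ.≤ s → ∣ p ℚ.* r ∣ ℚ.≤ q ℚ.* s
  *-mono-∣∣ p {q} r {s} q>0 p≤q r≤s = begin
    ∣ p ℚ.* r ∣       ≡⟨ ℚ.∣p*q∣≡∣p∣*∣q∣ p r ⟩
    ∣ p ∣ ℚ.* ∣ r ∣   ≤⟨ ℚ.*-monoʳ-≤-nonNeg ∣ r ∣ {{ℚ.∣-∣-nonNeg r}} p≤q ⟩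
    q ℚ.* ∣ r ∣       ≤⟨ ℚ.*-monoˡ-≤-nonNeg q {{ℚ.pos⇒nonNeg q {{q>0}}}} r≤s ⟩
    q ℚ.* s           ∎
    where open ℚ.≤-Reasoning

  divide : ∀ C ε → ℚ.Positive C → 0ℚ ℚ.< ε → ∃[ δ ] (0ℚ ℚ.< δ × C ℚ.* δ ≡ ε)
  divide C ε C>0 0<ε = C⁻¹ ℚ.* ε
    , subst (ℚ._< C⁻¹ ℚ.* ε) (ℚ.*-zeroʳ C⁻¹) (ℚ.*-monoʳ-<-pos C⁻¹ {{ℚ.1/pos⇒pos C {{C>0}}}} 0<ε)
    , trans (sym (ℚ.*-assoc C C⁻¹ ε))
        (trans (cong (ℚ._* ε) (ℚ.*-inverseʳ C {{ℚ.pos⇒nonZero C {{C>0}}}})) (ℚ.*-identityˡ ε))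
    where
    C⁻¹ : ℚ
    C⁻¹ = (ℚ.1/ C) {{ℚ.pos⇒nonZero C {{C>0}}}}

  *-difference : ∀ a b c d → a ℚ.* b ℚ.- c ℚ.* d ≡ a ℚ.* (b ℚ.- d) ℚ.+ d ℚ.* (a ℚ.- c)
  *-difference =
    solve 4 (λ a b c d → a :* b :- c :* d := a :* (b :- d) :+ d :* (a :- c)) refl
    where open +-*-Solver

  *-close : ∀ {A B δ} a b c d → ℚ.Positive A → ℚ.Positive B →
    ∣ a ∣ ℚ.≤ A → ∣ d ∣ ℚ.≤ B → ∣ a ℚ.- c ∣ ℚ.≤ δ → ∣ b ℚ.- d ∣ ℚ.≤ δ →
    ∣ a ℚ.* b ℚ.- c ℚ.* d ∣ ℚ.≤ (A ℚ.+ B) ℚ.* δ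
  *-close {A} {B} {δ} a b c d A>0 B>0 a≤A d≤B a-c≤δ b-d≤δ = begin
    ∣ a ℚ.* b ℚ.- c ℚ.* d ∣
      ≡⟨ cong ∣_∣ (*-difference a b c d) ⟩
    ∣ a ℚ.* (b ℚ.- d) ℚ.+ d ℚ.* (a ℚ.- c) ∣
      ≤⟨ ℚ.∣p+q∣≤∣p∣+∣q∣ (a ℚ.* (b ℚ.- d)) (d ℚ.* (a ℚ.- c)) ⟩
    ∣ a ℚ.* (b ℚ.- d) ∣ ℚ.+ ∣ d ℚ.* (a ℚ.- c) ∣
      ≤⟨ ℚ.+-mono-≤ (*-mono-∣∣ a (b ℚ.- d) A>0 a≤A b-d≤δ) (*-mono-∣∣ d (a ℚ.- c) B>0 d≤B a-c≤δ) ⟩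
    A ℚ.* δ ℚ.+ B ℚ.* δ
      ≡⟨ ℚ.*-distribʳ-+ δ A B ⟨
    (A ℚ.+ B) ℚ.* δ ∎
    where open ℚ.≤-Reasoning

  *-cauchy : ∀ x y → IsCauchy x → IsCauchy y → IsCauchy (λ k → x k ℚ.* y k)
  *-cauchy x y cx cy ε 0<ε =
    let
      A , M₁ , A>0 , x≤A = bounded cx
      B , M₂ , B>0 , y≤B = bounded cy
      δ , 0<δ , eq = divide (A ℚ.+ B) ε (ℚ.pos+pos⇒pos A {{A>0}} B {{B>0}}) 0<ε
      N₁ , cx′ = cx δ 0<δ
      N₂ , cy′ = cy δ 0<δ
    in (M₁ ℕ.⊔ M₂) ℕ.⊔ (N₁ ℕ.⊔ N₂) , λ i j i≥ j≥ →
      let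
        M≤i = ℕ.m⊔n≤o⇒m≤o (M₁ ℕ.⊔ M₂) _ i≥
        M≤j = ℕ.m⊔n≤o⇒m≤o (M₁ ℕ.⊔ M₂) _ j≥
        N≤i = ℕ.m⊔n≤o⇒n≤o (M₁ ℕ.⊔ M₂) _ i≥
        N≤j = ℕ.m⊔n≤o⇒n≤o (M₁ ℕ.⊔ M₂) _ j≥
      in subst (∣ x i ℚ.* y i ℚ.- x j ℚ.* y j ∣ ℚ.≤_) eq
           (*-close (x i) (y i) (x j) (y j) A>0 B>0
             (x≤A i (ℕ.m⊔n≤o⇒m≤o M₁ M₂ M≤i)) (y≤B j (ℕ.m⊔n≤o⇒n≤o M₁ M₂ M≤j))
             (cx′ i j (ℕ.m⊔n≤o⇒m≤o N₁ N₂ N≤i) (ℕ.m⊔n≤o⇒m≤o N₁ N₂ N≤j))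
             (cy′ i j (ℕ.m⊔n≤o⇒n≤o N₁ N₂ N≤i) (ℕ.m⊔n≤o⇒n≤o N₁ N₂ N≤j)))

  const-cauchy : ∀ q → IsCauchy (λ _ → q)
  const-cauchy q ε 0<ε = 0 , λ _ _ _ _ →
    subst (λ t → ∣ t ∣ ℚ.≤ ε) (sym (ℚ.+-inverseʳ q)) (ℚ.<⇒≤ 0<ε)

open RealLemmas using (+-cauchy; neg-cauchy; *-cauchy; const-cauchy)

infixl 6 _+ᵣ_ _-ᵣ_
infixl 7 _*ᵣ_
infix  4 _≤ᵣ_

fromℚ : ℚ → ℝ
fromℚ q = mkℝ (λ _ → q) (const-cauchy q)

0ℝ 1ℝ : ℝ
0ℝ = fromℚ 0ℚ
1ℝ = fromℚ 1ℚ

_+ᵣ_ _*ᵣ_ _-ᵣ_ : ℝ → ℝ → ℝ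
x +ᵣ y = mkℝ (λ k → seq x k ℚ.+ seq y k) (+-cauchy (seq x) (seq y) (cauchy x) (cauchy y))
x *ᵣ y = mkℝ (λ k → seq x k ℚ.* seq y k) (*-cauchy (seq x) (seq y) (cauchy x) (cauchy y))
x -ᵣ y = mkℝ (λ k → seq x k ℚ.- seq y k)
  (+-cauchy (seq x) (λ k → ℚ.- seq y k) (cauchy x) (neg-cauchy (seq y) (cauchy y)))

_≤ᵣ_ : ℝ → ℝ → Set
x ≤ᵣ y = ∀ ε → 0ℚ ℚ.< ε → ∃[ N ] (∀ k → N ℕ.≤ k → seq x k ℚ.≤ seq y k ℚ.+ ε)

-- The natural logarithm of a positive integer, as ∫₁ⁿ dt/t.

-- recipSum s l = 1/(s+1) + 1/(s+2) + ⋯ + 1/(s+l)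
recipSum : ℕ → ℕ → ℚ
recipSum s zero    = 0ℚ
recipSum s (suc l) = + 1 ℚ./ suc s ℚ.+ recipSum (suc s) l

-- With k = suc m, the right-endpoint Riemann sum of 1/t over [1, n] with mesh
-- 1/k is  Σ_{1≤j≤(n-1)k} (1/k) · 1/(1 + j/k)  =  Σ_{1≤j≤(n-1)k} 1/(k+j).
riemannSum : ℕ → ℕ → ℚ
riemannSum n m = recipSum (suc m) ((n ℕ.∸ 1) ℕ.* suc m)

module LogLemmas where
  open RealLemmas using (∣p∣≤)

  r : ℕ → ℚ
  r i = + 1 ℚ./ suc i

  copies : ℕ → ℚ → ℚ
  copies zero    q = 0ℚ
  copies (suc b) q = q ℚ.+ copies b q

  toℚᵘ-r : ∀ i → toℚᵘ (r i) ℚᵘ.≃ mkℚᵘ (+ 1) i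
  toℚᵘ-r i = ℚ.toℚᵘ-fromℚᵘ (mkℚᵘ (+ 1) i)

  r-anti : ∀ {i j} → i ℕ.≤ j → r j ℚ.≤ r i
  r-anti {i} {j} i≤j = ℚ.toℚᵘ-cancel-≤ (begin
    toℚᵘ (r j)      ≃⟨ toℚᵘ-r j ⟩
    mkℚᵘ (+ 1) j    ≤⟨ *≤* (ℤ.*-monoˡ-≤-nonNeg (+ 1) (ℤ.+≤+ (s≤s i≤j))) ⟩
    mkℚᵘ (+ 1) i    ≃⟨ toℚᵘ-r i ⟨
    toℚᵘ (r i)      ∎)
    where open ℚᵘ.≤-Reasoning

  0≤r : ∀ i → 0ℚ ℚ.≤ r i
  0≤r i = ℚ.nonNegative⁻¹ (r i) {{ℚ.normalize-nonNeg 1 (suc i)}}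

  copies-≃ : ∀ b N → toℚᵘ (copies b (r N)) ℚᵘ.≃ mkℚᵘ (+ b) N
  copies-≃ zero    N = *≡* refl
  copies-≃ (suc b) N = begin-equality
    toℚᵘ (r N ℚ.+ copies b (r N))           ≃⟨ ℚ.toℚᵘ-homo-+ (r N) (copies b (r N)) ⟩
    toℚᵘ (r N) ℚᵘ.+ toℚᵘ (copies b (r N))   ≃⟨ ℚᵘ.+-cong (toℚᵘ-r N) (copies-≃ b N) ⟩
    mkℚᵘ (+ 1) N ℚᵘ.+ mkℚᵘ (+ b) N          ≃⟨ *≡* (eq (+ b) (+ suc N)) ⟩
    mkℚᵘ (+ suc b) N                        ∎
    where
    open ℚᵘ.≤-Reasoning
    eq : ∀ c M → (+ 1 ℤ.* M ℤ.+ c ℤ.* M) ℤ.* M ≡ (+ 1 ℤ.+ c) ℤ.* (M ℤ.* M)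
    eq c M = trans (cong (ℤ._* M) (sym (ℤ.*-distribʳ-+ M (+ 1) c))) (ℤ.*-assoc (+ 1 ℤ.+ c) M M)

  copies-r : ∀ b s N → suc N ≡ suc s ℕ.* b → copies b (r N) ≡ r s
  copies-r b s N eq = ℚ.toℚᵘ-injective (begin-equality
    toℚᵘ (copies b (r N))  ≃⟨ copies-≃ b N ⟩
    mkℚᵘ (+ b) N           ≃⟨ *≡* lem ⟩
    mkℚᵘ (+ 1) s           ≃⟨ toℚᵘ-r s ⟨
    toℚᵘ (r s)             ∎)
    where
    open ℚᵘ.≤-Reasoning
    lem : + b ℤ.* + suc s ≡ + 1 ℤ.* + suc N
    lem = trans (sym (ℤ.pos-* b (suc s)))
            (trans (cong +_ (trans (ℕ.*-comm b (suc s)) (trans (sym eq) (sym (ℕ.*-identityˡ (suc N))))))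
              (ℤ.pos-* 1 (suc N)))

  recipSum-++ : ∀ s k l → recipSum s (k ℕ.+ l) ≡ recipSum s k ℚ.+ recipSum (k ℕ.+ s) l
  recipSum-++ s zero    l = sym (ℚ.+-identityˡ _)
  recipSum-++ s (suc k) l = trans
    (cong (r s ℚ.+_) (trans (recipSum-++ (suc s) k l)
      (cong (λ t → recipSum (suc s) k ℚ.+ recipSum t l) (ℕ.+-suc k s))))
    (sym (ℚ.+-assoc (r s) _ _))

  recipSum-lower : ∀ s b N → s ℕ.+ b ℕ.≤ suc N → copies b (r N) ℚ.≤ recipSum s b
  recipSum-lower s zero    N _ = ℚ.≤-refl
  recipSum-lower s (suc b) N h = ℚ.+-mono-≤
    (r-anti (ℕ.≤-trans (ℕ.m≤m+n s b) (ℕ.s≤s⁻¹ (subst (ℕ._≤ suc N) (ℕ.+-suc s b) h))))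
    (recipSum-lower (suc s) b N (subst (ℕ._≤ suc N) (ℕ.+-suc s b) h))

  recipSum-upper : ∀ s b N → N ℕ.≤ s → recipSum s b ℚ.≤ copies b (r N)
  recipSum-upper s zero    N _ = ℚ.≤-refl
  recipSum-upper s (suc b) N h =
    ℚ.+-mono-≤ (r-anti h) (recipSum-upper (suc s) b N (ℕ.m≤n⇒m≤1+n h))

  refine-lower : ∀ b s l → recipSum s l ℚ.≤ recipSum (s ℕ.* suc b) (l ℕ.* suc b)
  refine-lower b s zero    = ℚ.≤-refl
  refine-lower b s (suc l) = begin
    r s ℚ.+ recipSum (suc s) l
      ≡⟨ cong (ℚ._+ recipSum (suc s) l) (sym (copies-r (suc b) s (b ℕ.+ s ℕ.* suc b) refl)) ⟩
    copies (suc b) (r (b ℕ.+ s ℕ.* suc b)) ℚ.+ recipSum (suc s) l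
      ≤⟨ ℚ.+-mono-≤ (recipSum-lower (s ℕ.* suc b) (suc b) _ (ℕ.≤-reflexive (ℕ.+-comm (s ℕ.* suc b) (suc b)))) (refine-lower b (suc s) l) ⟩
    recipSum (s ℕ.* suc b) (suc b) ℚ.+ recipSum (suc b ℕ.+ s ℕ.* suc b) (l ℕ.* suc b)
      ≡⟨ recipSum-++ (s ℕ.* suc b) (suc b) (l ℕ.* suc b) ⟨
    recipSum (s ℕ.* suc b) (suc b ℕ.+ l ℕ.* suc b) ∎
    where open ℚ.≤-Reasoning

  refine-upper : ∀ b s l → recipSum (suc s ℕ.* suc b) (l ℕ.* suc b) ℚ.≤ recipSum s l
  refine-upper b s zero    = ℚ.≤-refl
  refine-upper b s (suc l) = begin
    recipSum (suc s ℕ.* suc b) (suc b ℕ.+ l ℕ.* suc b)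
      ≡⟨ recipSum-++ (suc s ℕ.* suc b) (suc b) (l ℕ.* suc b) ⟩
    recipSum (suc s ℕ.* suc b) (suc b) ℚ.+ recipSum (suc (suc s) ℕ.* suc b) (l ℕ.* suc b)
      ≤⟨ ℚ.+-mono-≤ (recipSum-upper (suc s ℕ.* suc b) (suc b) N (ℕ.n≤1+n N)) (refine-upper b (suc s) l) ⟩
    copies (suc b) (r N) ℚ.+ recipSum (suc s) l
      ≡⟨ cong (ℚ._+ recipSum (suc s) l) (copies-r (suc b) s N refl) ⟩
    r s ℚ.+ recipSum (suc s) l ∎
    where
    open ℚ.≤-Reasoning
    N = b ℕ.+ s ℕ.* suc b

  recipSum-shift : ∀ s l → recipSum s l ℚ.≤ r s ℚ.+ recipSum (suc s) l
  recipSum-shift s zero    = subst (0ℚ ℚ.≤_) (sym (ℚ.+-identityʳ (r s))) (0≤r s)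
  recipSum-shift s (suc l) = ℚ.+-monoʳ-≤ (r s) (recipSum-shift (suc s) l)

  riemannSum-close : ∀ n i j → riemannSum n j ℚ.≤ r i ℚ.+ riemannSum n i
  riemannSum-close n i j = begin
    recipSum (suc j) (l ℕ.* suc j)
      ≤⟨ refine-lower i (suc j) (l ℕ.* suc j) ⟩
    recipSum (suc j ℕ.* suc i) (l ℕ.* suc j ℕ.* suc i)
      ≡⟨ cong₂ recipSum (ℕ.*-comm (suc j) (suc i)) (swap l (suc j) (suc i)) ⟩
    recipSum (suc i ℕ.* suc j) (l ℕ.* suc i ℕ.* suc j)
      ≤⟨ refine-upper j i (l ℕ.* suc i) ⟩
    recipSum i (l ℕ.* suc i)
      ≤⟨ recipSum-shift i (l ℕ.* suc i) ⟩
    r i ℚ.+ recipSum (suc i) (l ℕ.* suc i) ∎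
    where
    open ℚ.≤-Reasoning
    l = n ℕ.∸ 1
    swap : ∀ a b c → a ℕ.* b ℕ.* c ≡ a ℕ.* c ℕ.* b
    swap = solve-∀

  archimedean : ∀ ε → 0ℚ ℚ.< ε → ∃[ N ] r N ℚ.≤ ε
  archimedean (mkℚ (+ zero)   d c) (*<* (ℤ.+<+ ()))
  archimedean (mkℚ -[1+ a ]   d c) (*<* ())
  archimedean ε@(mkℚ (+ suc a) d c) _ = d , ℚ.toℚᵘ-cancel-≤ (begin
    toℚᵘ (r d)        ≃⟨ toℚᵘ-r d ⟩
    mkℚᵘ (+ 1) d      ≤⟨ *≤* (ℤ.*-monoʳ-≤-nonNeg (+ suc d) {+ 1} {+ suc a} (ℤ.+≤+ (s≤s z≤n))) ⟩
    toℚᵘ ε            ∎)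
    where open ℚᵘ.≤-Reasoning

  riemannSum-cauchy : ∀ n → IsCauchy (riemannSum n)
  riemannSum-cauchy n ε 0<ε with archimedean ε 0<ε
  ... | N , r≤ε = N , λ i j i≥ j≥ →
    ∣p∣≤ (one i j j≥) (subst (ℚ._≤ ε)
      (solve 2 (λ a b → b :- a := :- (a :- b)) refl (riemannSum n i) (riemannSum n j))
      (one j i i≥))
    where
    open +-*-Solver
    one : ∀ i j → N ℕ.≤ j → riemannSum n i ℚ.- riemannSum n j ℚ.≤ ε
    one i j j≥ = begin
      riemannSum n i ℚ.- riemannSum n j
        ≤⟨ ℚ.+-monoˡ-≤ (ℚ.- riemannSum n j) (riemannSum-close n j i) ⟩
      r j ℚ.+ riemannSum n j ℚ.- riemannSum n j
        ≡⟨ solve 2 (λ a b → (a :+ b) :- b := a) refl (r j) (riemannSum n j) ⟩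
      r j ≤⟨ r-anti j≥ ⟩
      r N ≤⟨ r≤ε ⟩
      ε   ∎
      where open ℚ.≤-Reasoning

open LogLemmas using (riemannSum-cauchy)

log : (n : ℕ) .{{_ : ℕ.NonZero n}} → ℝ
log n = mkℝ (riemannSum n) (riemannSum-cauchy n)

module Search where

  Complete : ∀ {A : Set} → List A → Set
  Complete xs = ∀ x → x ∈ xs

  any? : ∀ {A : Set} {P : A → Set} {xs} → Complete xs → Decidable P → Dec (∃ P)
  any? {xs = xs} c P? =
    map′ Any.satisfied (λ (x , px) → lose (c x) px) (Any.any? P? xs)

  all? : ∀ {A : Set} {P : A → Set} {xs} → Complete xs → Decidable P → Dec (∀ x → P x)
  all? {xs = xs} c P? =
    map′ (λ ps x → All.lookup ps (c x)) (λ f → All.universal f xs) (All.all? P? xs)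

  listsUpTo : ∀ {A : Set} → List A → ℕ → List (List A)
  listsUpTo xs zero    = [] ∷ []
  listsUpTo xs (suc k) = [] ∷ cartesianProductWith _∷_ xs (listsUpTo xs k)

  listsUpTo-complete : ∀ {A : Set} {xs : List A} → Complete xs →
    ∀ k ys → length ys ℕ.≤ k → ys ∈ listsUpTo xs k
  listsUpTo-complete c zero    []       _       = here refl
  listsUpTo-complete c (suc k) []       _       = here refl
  listsUpTo-complete c (suc k) (y ∷ ys) (s≤s h) =
    there (∈-cartesianProductWith⁺ _∷_ (c y) (listsUpTo-complete c k ys h))

  anyList? : ∀ {A : Set} {P : List A → Set} {xs} → Complete xs → ∀ k →
    (∀ {ys} → P ys → length ys ℕ.≤ k) → Decidable P → Dec (∃ P)
  anyList? {xs = xs} c k short P? =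
    map′ Any.satisfied (λ (ys , p) → lose (listsUpTo-complete c k ys (short p)) p)
      (Any.any? P? (listsUpTo xs k))

  lookup-injective : ∀ {A : Set} {xs : List A} → Unique xs →
    ∀ i j → List.lookup xs i ≡ List.lookup xs j → i ≡ j
  lookup-injective (p ∷ u) zero    zero    eq = refl
  lookup-injective {xs = x ∷ xs} (p ∷ u) zero    (suc j) eq = contradiction eq (All.lookup p (∈-lookup j))
  lookup-injective {xs = x ∷ xs} (p ∷ u) (suc i) zero    eq = contradiction (sym eq) (All.lookup p (∈-lookup i))
  lookup-injective (p ∷ u) (suc i) (suc j) eq = cong suc (lookup-injective u i j eq)

  unique⇒short : ∀ {A : Set} {xs ys : List A} → Complete xs → Unique ys →
    length ys ℕ.≤ length xs
  unique⇒short {xs = xs} {ys} c u = Fin.injective⇒≤ {f = f} λ {i} {j} eq →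
    lookup-injective u i j (trans (Any.lookup-index (c (List.lookup ys i)))
      (trans (cong (List.lookup xs) eq) (sym (Any.lookup-index (c (List.lookup ys j))))))
    where
    f : Fin (length ys) → Fin (length xs)
    f i = Any.index (c (List.lookup ys i))

  least : ∀ {P : ℕ → Set} → Decidable P → ∃ P → ∃[ k ] (P k × (∀ j → P j → k ℕ.≤ j))
  least {P} P? (b , Pb) = go b P P? Pb
    where
    go : ∀ b (P : ℕ → Set) → Decidable P → P b → ∃[ k ] (P k × (∀ j → P j → k ℕ.≤ j))
    go b P P? Pb with P? 0
    go b       P P? Pb | yes P0 = 0 , P0 , λ _ _ → z≤n
    go zero    P P? Pb | no ¬P0 = contradiction Pb ¬P0
    go (suc b) P P? Pb | no ¬P0 with go b (P ∘ suc) (P? ∘ suc) Pb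
    ... | k , Pk , min = suc k , Pk ,
      λ { zero P0 → contradiction P0 ¬P0 ; (suc j) Pj → s≤s (min j Pj) }

open Search using (Complete)

-- Every vector with entries from xs, once each when xs has no repetitions.
vectors : ∀ {A : Set} → List A → ∀ n → List (Vec A n)
vectors xs zero    = [] ∷ []
vectors xs (suc n) = cartesianProductWith _∷_ xs (vectors xs n)

vectors-complete : ∀ {A : Set} {xs : List A} → Complete xs → ∀ n → Complete (vectors xs n)
vectors-complete c zero    []       = here refl
vectors-complete c (suc n) (v ∷ vs) =
  ∈-cartesianProductWith⁺ _∷_ (c v) (vectors-complete c n vs)

matrices : ∀ {A : Set} → List A → ∀ n m → List (Vec (Vec A m) n)
matrices xs n m = vectors (vectors xs m) n

entry : ∀ {A : Set} {n m} → Vec (Vec A m) n → Fin n → Fin m → A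
entry M i j = Vec.lookup (Vec.lookup M i) j

Vertex : ℕ → ℕ → Set
Vertex n m = Fin n ⊎ Fin m

-- The biadjacency matrix of a bipartite graph on the classes Fin n and Fin m.
Graph : ℕ → ℕ → Set
Graph n m = Vec (Vec Bool m) n

HasEdge : ∀ {n m} → Graph n m → Fin n → Fin m → Set
HasEdge E i j = entry E i j ≡ true

Adjacent : ∀ {n m} → Graph n m → Vertex n m → Vertex n m → Set
Adjacent E (inj₁ i) (inj₂ j) = HasEdge E i j
Adjacent E (inj₂ j) (inj₁ i) = HasEdge E i j
Adjacent E (inj₁ _) (inj₁ _) = ⊥
Adjacent E (inj₂ _) (inj₂ _) = ⊥

IsPath : ∀ {n m} → Graph n m → Vertex n m → Vertex n m → List (Vertex n m) → Set
IsPath E u v xs =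
  head xs ≡ just u × last xs ≡ just v × Linked (Adjacent E) xs × Unique xs

record Subgraph (n m : ℕ) : Set where
  constructor subgraph
  field
    left  : Subset n
    right : Subset m
    edges : Graph n m

open Subgraph public

infix 4 _∈ᵛ_
_∈ᵛ_ : ∀ {n m} → Vertex n m → Subgraph n m → Set
inj₁ i ∈ᵛ H = i ∈ˢ left H
inj₂ j ∈ᵛ H = j ∈ˢ right H

IsSubgraphOf : ∀ {n m} → Graph n m → Subgraph n m → Set
IsSubgraphOf G H = ∀ i j → HasEdge (edges H) i j →
  HasEdge G i j × inj₁ i ∈ᵛ H × inj₂ j ∈ᵛ H

Connected : ∀ {n m} → Subgraph n m → Set
Connected H = ∀ u v → u ∈ᵛ H → v ∈ᵛ H → ∃ (IsPath (edges H) u v)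

HasCycle : ∀ {n m} → Subgraph n m → Set
HasCycle H = ∃[ xs ] (3 ℕ.≤ length xs ×
  ∃[ u ] ∃[ v ] (IsPath (edges H) u v xs × Adjacent (edges H) v u))

IsTree : ∀ {n m} → Subgraph n m → Set
IsTree H = (∃[ v ] v ∈ᵛ H) × Connected H × ¬ HasCycle H

Colour : Set
Colour = Fin 2

-- Colours are assigned to all pairs; those of non-edges are never consulted.
Colouring : ℕ → ℕ → Set
Colouring n m = Vec (Vec Colour m) n

IsMonochromatic : ∀ {n m} → Colouring n m → Subgraph n m → Set
IsMonochromatic χ H = ∃[ c ] (∀ i j → HasEdge (edges H) i j → entry χ i j ≡ c)

IsMonochromaticTree : ∀ {n m} → Graph n m → Colouring n m → Subgraph n m → Set
IsMonochromaticTree G χ H = IsSubgraphOf G H × IsTree H × IsMonochromatic χ H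

IsTreeCover : ∀ {n m} → Graph n m → Colouring n m → ℕ → List (Subgraph n m) → Set
IsTreeCover G χ k Ts = length Ts ℕ.≤ k
  × All (IsMonochromaticTree G χ) Ts
  × (∀ v → Any (v ∈ᵛ_) Ts)

Coverable : ∀ {n m} → Graph n m → ℕ → Set
Coverable G k = ∀ χ → ∃ (IsTreeCover G χ k)

module GraphLemmas {n m : ℕ} where
  open Search

  bools-complete : Complete (false ∷ true ∷ [])
  bools-complete false = here refl
  bools-complete true  = there (here refl)

  vertices : List (Vertex n m)
  vertices = List.map inj₁ (allFin n) List.++ List.map inj₂ (allFin m)

  vertices-complete : Complete vertices
  vertices-complete (inj₁ i) = ∈-++⁺ˡ (∈-map⁺ inj₁ (∈-allFin i))
  vertices-complete (inj₂ j) = ∈-++⁺ʳ (List.map inj₁ (allFin n)) (∈-map⁺ inj₂ (∈-allFin j))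

  subgraphs : List (Subgraph n m)
  subgraphs = cartesianProductWith (λ (l , r) E → subgraph l r E)
    (cartesianProductWith _,_ (vectors (false ∷ true ∷ []) n) (vectors (false ∷ true ∷ []) m))
    (matrices (false ∷ true ∷ []) n m)

  subgraphs-complete : Complete subgraphs
  subgraphs-complete (subgraph l r E) = ∈-cartesianProductWith⁺ _
    (∈-cartesianProductWith⁺ _,_ (vectors-complete bools-complete n l)
                                 (vectors-complete bools-complete m r))
    (vectors-complete (vectors-complete bools-complete m) n E)

  colourings-complete : Complete (matrices (allFin 2) n m)
  colourings-complete = vectors-complete (vectors-complete ∈-allFin m) n

  _≟ᵛ_ : DecidableEquality (Vertex n m)
  _≟ᵛ_ = Sum.≡-dec Fin._≟_ Fin._≟_

  hasEdge? : ∀ (E : Graph n m) i j → Dec (HasEdge E i j)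
  hasEdge? E i j = entry E i j ≟ᵇ true

  adjacent? : ∀ (E : Graph n m) → Binary.Decidable (Adjacent E)
  adjacent? E (inj₁ i) (inj₂ j) = hasEdge? E i j
  adjacent? E (inj₂ j) (inj₁ i) = hasEdge? E i j
  adjacent? E (inj₁ _) (inj₁ _) = no λ ()
  adjacent? E (inj₂ _) (inj₂ _) = no λ ()

  isPath? : ∀ (E : Graph n m) u v → Decidable (IsPath E u v)
  isPath? E u v xs = Maybe.≡-dec _≟ᵛ_ (head xs) (just u)
    ×-dec Maybe.≡-dec _≟ᵛ_ (last xs) (just v)
    ×-dec linked? (adjacent? E) xs
    ×-dec DecUnique.unique? _≟ᵛ_ xs

  path⇒short : ∀ {E : Graph n m} {u v xs} → IsPath E u v xs → length xs ℕ.≤ length vertices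
  path⇒short (_ , _ , _ , unique) = unique⇒short vertices-complete unique

  member? : ∀ (H : Subgraph n m) → Decidable (_∈ᵛ H)
  member? H (inj₁ i) = i ∈ˢ? left H
  member? H (inj₂ j) = j ∈ˢ? right H

  isSubgraphOf? : ∀ (G : Graph n m) → Decidable (IsSubgraphOf G)
  isSubgraphOf? G H = Fin.all? λ i → Fin.all? λ j → hasEdge? (edges H) i j →-dec
    (hasEdge? G i j ×-dec (i ∈ˢ? left H) ×-dec (j ∈ˢ? right H))

  connected? : Decidable (Connected {n} {m})
  connected? H = all? vertices-complete λ u → all? vertices-complete λ v →
    member? H u →-dec member? H v →-dec
      anyList? vertices-complete (length vertices) path⇒short (isPath? (edges H) u v)

  hasCycle? : Decidable (HasCycle {n} {m})
  hasCycle? H = anyList? vertices-complete (length vertices)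
    (λ (_ , _ , _ , path , _) → path⇒short path)
    (λ xs → (3 ℕ.≤? length xs) ×-dec
      any? vertices-complete λ u → any? vertices-complete λ v →
        isPath? (edges H) u v xs ×-dec adjacent? (edges H) v u)

  isTree? : Decidable (IsTree {n} {m})
  isTree? H = any? vertices-complete (member? H) ×-dec connected? H ×-dec ¬? (hasCycle? H)

  isMonochromatic? : ∀ (χ : Colouring n m) → Decidable (IsMonochromatic χ)
  isMonochromatic? χ H = Fin.any? λ c → Fin.all? λ i → Fin.all? λ j →
    hasEdge? (edges H) i j →-dec (entry χ i j Fin.≟ c)

  isTreeCover? : ∀ (G : Graph n m) χ k → Decidable (IsTreeCover G χ k)
  isTreeCover? G χ k Ts = (length Ts ℕ.≤? k)
    ×-dec All.all? (λ H → isSubgraphOf? G H ×-dec isTree? H ×-dec isMonochromatic? χ H) Ts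
    ×-dec all? vertices-complete (λ v → Any.any? (λ H → member? H v) Ts)

  coverable? : ∀ (G : Graph n m) → Decidable (Coverable G)
  coverable? G k = all? colourings-complete λ χ →
    anyList? subgraphs-complete k proj₁ (isTreeCover? G χ k)

  noEdges : Graph n m
  noEdges = Vec.replicate n (Vec.replicate m false)

  noEdges-empty : ∀ i j → ¬ HasEdge noEdges i j
  noEdges-empty i j eq
    with trans (sym eq) (trans (cong (λ row → Vec.lookup row j) (Vec.lookup-replicate i _))
                               (Vec.lookup-replicate j false))
  ... | ()

  singleton : Vertex n m → Subgraph n m
  singleton (inj₁ i) = subgraph ⁅ i ⁆ ∅ noEdges
  singleton (inj₂ j) = subgraph ∅ ⁅ j ⁆ noEdges

  ∈-singleton : ∀ v → v ∈ᵛ singleton v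
  ∈-singleton (inj₁ i) = x∈⁅x⁆ i
  ∈-singleton (inj₂ j) = x∈⁅x⁆ j

  ∈-singleton⁻ : ∀ u v → u ∈ᵛ singleton v → u ≡ v
  ∈-singleton⁻ (inj₁ i) (inj₁ _) p = cong inj₁ (x∈⁅y⁆⇒x≡y _ p)
  ∈-singleton⁻ (inj₂ i) (inj₂ _) p = cong inj₂ (x∈⁅y⁆⇒x≡y _ p)
  ∈-singleton⁻ (inj₁ i) (inj₂ _) p = contradiction p ∉⊥
  ∈-singleton⁻ (inj₂ i) (inj₁ _) p = contradiction p ∉⊥

  singleton-edges : ∀ v → edges (singleton v) ≡ noEdges
  singleton-edges (inj₁ _) = refl
  singleton-edges (inj₂ _) = refl

  noEdges-¬adjacent : ∀ u v → ¬ Adjacent noEdges u v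
  noEdges-¬adjacent (inj₁ i) (inj₂ j) = noEdges-empty i j
  noEdges-¬adjacent (inj₂ j) (inj₁ i) = noEdges-empty i j

  singleton-isMonochromaticTree : ∀ G χ v → IsMonochromaticTree G χ (singleton v)
  singleton-isMonochromaticTree G χ v
    = (λ i j e → contradiction e (empty i j))
    , ((v , ∈-singleton v) , connected , acyclic)
    , zero , λ i j e → contradiction e (empty i j)
    where
    empty : ∀ i j → ¬ HasEdge (edges (singleton v)) i j
    empty i j = subst (λ E → ¬ HasEdge E i j) (sym (singleton-edges v)) (noEdges-empty i j)
    connected : Connected (singleton v)
    connected u w u∈ w∈ with ∈-singleton⁻ u v u∈ | ∈-singleton⁻ w v w∈
    ... | refl | refl = v ∷ [] , refl , refl , [-] , [] ∷ []
    acyclic : ¬ HasCycle (singleton v)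
    acyclic (_ , _ , a , b , _ , e) =
      noEdges-¬adjacent b a (subst (λ E → Adjacent E b a) (singleton-edges v) e)

  coverable : ∀ (G : Graph n m) → ∃ (Coverable G)
  coverable G = length vertices , λ χ → List.map singleton vertices
    , ℕ.≤-reflexive (length-map singleton vertices)
    , All.map⁺ (All.universal (λ v → singleton-isMonochromaticTree G χ v) vertices)
    , λ v → Any.map⁺ (Any.map (λ eq → subst (λ u → v ∈ᵛ singleton u) eq (∈-singleton v)) (vertices-complete v))

open GraphLemmas using (coverable?; coverable)

tc₂ : ∀ {n m} → Graph n m → ℕ
tc₂ G = proj₁ (Search.least (coverable? G) (coverable G))

tc₂-coverable : ∀ {n m} (G : Graph n m) → Coverable G (tc₂ G)
tc₂-coverable G = proj₁ (proj₂ (Search.least (coverable? G) (coverable G)))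

tc₂-minimal : ∀ {n m} (G : Graph n m) k → Coverable G k → tc₂ G ℕ.≤ k
tc₂-minimal G = proj₂ (proj₂ (Search.least (coverable? G) (coverable G)))

∑ : List ℝ → ℝ
∑ = List.foldr _+ᵣ_ 0ℝ

∏ : ∀ {n} → Vec ℝ n → ℝ
∏ = Vec.foldr′ _*ᵣ_ 1ℝ

weight : ∀ {n m} → ℝ → Graph n m → ℝ
weight p G = ∏ (Vec.map (λ row → ∏ (Vec.map (λ e → if e then p else 1ℝ -ᵣ p) row)) G)

graphs : ∀ n m → List (Graph n m)
graphs = matrices (false ∷ true ∷ [])

Pr : ∀ n m (p : ℝ) {A : Graph n m → Set} → Decidable A → ℝ
Pr n m p A? = ∑ (List.map (weight p) (filter A? (graphs n m)))

-- Probability 1 - o(1) as n → ∞, for the sequence of events A n about G(n,n,p(n)).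
WithHighProbability : (p : ℕ → ℝ) {A : ∀ n → Graph n n → Set} → (∀ n → Decidable (A n)) → Set
WithHighProbability p A? = ∀ ε → 0ℚ ℚ.< ε →
  ∃[ N ] (∀ n → N ℕ.≤ n → 1ℝ -ᵣ fromℚ ε ≤ᵣ Pr n n (p n) (A? n))

module Submission where

-- Suppose that a row vertex a has two distinct non-neighbours b and j.  Colour the edges at a
-- and at b blue and all others red.  Then no monochromatic tree contains two of a, b, j: the
-- blue component of a is a star avoiding b and j, a is isolated in red, b is isolated in red,
-- and j is isolated in blue.  Hence three trees are needed.
--
-- If a has at most one non-neighbour, then it is adjacent to all of S or to all of the
-- complement of S, where S is a fixed set of about n/2 columns.  By Bernoulli's inequality
-- pᵏ (1 + k (1 - p)) ≤ 1 each of these events has probability O(1 / log n), already for a single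
-- vertex a.

open import Defs
open import Data.Bool.Base using (Bool; true; false; if_then_else_; _∨_)
open import Data.Fin.Base using (Fin; zero; suc)
open import Data.Fin.Properties using (_≟_)
open import Data.Fin.Subset using (Subset; ∁) renaming (_∈_ to _∈ˢ_; ⊥ to ∅; ∣_∣ to size)
open import Data.Fin.Subset.Properties using (x∈p⇒x∉∁p)
open import Data.Integer.Base using (+_)
open import Data.List.Base as List
  using (List; []; _∷_; _++_; length; head; last; filter; cartesianProductWith)
open import Data.List.Properties using (map-++)
import Data.List.Relation.Unary.All as All
open import Data.List.Relation.Unary.Any using (Any; here; there)
open import Data.List.Relation.Unary.Linked using (Linked; [-]; _∷_)
open import Data.Maybe.Base using (just)
open import Data.Maybe.Properties using (just-injective)
open import Data.Nat.Base as ℕ using (ℕ; zero; suc; NonZero; _≤_; s≤s; z≤n)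
import Data.Nat.Properties as ℕ
open import Data.Nat.Properties using (_≤?_)
open import Data.Nat.Tactic.RingSolver using (solve-∀)
open import Data.Product.Base using (∃-syntax; _×_; _,_; proj₁; proj₂)
open import Data.Rational.Base as ℚ using (ℚ; 0ℚ; 1ℚ; _/_; ∣_∣)
import Data.Rational.Properties as ℚ
open import Data.Rational.Solver using (module +-*-Solver)
open import Data.Rational.Unnormalised.Base using (mkℚᵘ)
import Data.Rational.Unnormalised.Properties as ℚᵘ
open import Data.Sum.Base using (_⊎_; inj₁; inj₂)
open import Data.Sum.Properties using (inj₂-injective)
open import Data.Vec.Base as Vec using (Vec; []; _∷_; here; there; zipWith; replicate)
open import Data.Vec.Properties using (lookup∘tabulate; map-cong)
open import Relation.Binary.PropositionalEquality
open import Relation.Nullary using (¬_; yes; no; does; contradiction)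
open import Relation.Unary using (Decidable)

open LogLemmas using (r; 0≤r; copies; copies-r; copies-≃; recipSum-++; recipSum-lower; archimedean)
open RealLemmas using (∣p∣≤; half; bounded; divide; *-close)
open +-*-Solver using (solve; con; _:+_; _:*_; _:-_; :-_; _:=_)

-- A colouring that needs three trees

Closed : ∀ {n m} → Subgraph n m → (Vertex n m → Set) → Set
Closed H P = ∀ x y → P x → Adjacent (edges H) x y → P y

-- The property travels along the path from `u` to `v`, one edge at a time. It is applied to sets
-- that contain the whole component of a vertex in one colour, to show that a tree meeting such a
-- set stays inside it.
connected-closed : ∀ {n m} {H : Subgraph n m} {P} → Connected H → Closed H P →
  ∀ u v → u ∈ᵛ H → v ∈ᵛ H → P u → P v
connected-closed {H = H} {P} connected closed u v u∈H v∈H Pu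
  with connected u v u∈H v∈H
... | xs , head≡u , last≡v , linked , _ = along xs head≡u last≡v linked Pu
  where
  along : ∀ xs {u} → head xs ≡ just u → last xs ≡ just v → Linked (Adjacent (edges H)) xs →
    P u → P v
  along (x ∷ [])     h l [-]     Pu = subst P (trans (sym (just-injective h)) (just-injective l)) Pu
  along (x ∷ y ∷ xs) h l (e ∷ L) Pu =
    along (y ∷ xs) refl l L (closed x y (subst P (sym (just-injective h)) Pu) e)

-- Pigeonhole. The shared pair is located at an entry of the list, so that `All.lookupAny` can
-- supply the tree properties of that entry.
two-share : ∀ {A : Set} {P Q R : A → Set} {xs} → length xs ≤ 2 → Any P xs → Any Q xs → Any R xs →
  Any (λ x → P x × Q x ⊎ P x × R x ⊎ Q x × R x) xs
two-share _ (here p) (here q) _ = here (inj₁ (p , q))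
two-share _ (here p) (there _) (here r) = here (inj₂ (inj₁ (p , r)))
two-share _ (here p) (there (here q)) (there (here r)) = there (here (inj₂ (inj₂ (q , r))))
two-share _ (there _) (here q) (here r) = here (inj₂ (inj₂ (q , r)))
two-share _ (there (here p)) (here q) (there (here r)) = there (here (inj₂ (inj₁ (p , r))))
two-share _ (there (here p)) (there (here q)) _ = there (here (inj₁ (p , q)))
two-share {xs = _ ∷ _ ∷ _ ∷ _} (s≤s (s≤s ()))

module _ {n m} (G : Graph n m) (a : Fin n) (b : Fin m) where

  pattern red  = zero
  pattern blue = suc zero

  colour : Fin n → Fin m → Colour
  colour i j = if does (i ≟ a) ∨ does (j ≟ b) then blue else red

  colouring : Colouring n m
  colouring = Vec.tabulate λ i → Vec.tabulate (colour i)

  entry-colouring : ∀ i j → entry colouring i j ≡ colour i j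
  entry-colouring i j = trans
    (cong (λ row → Vec.lookup row j) (lookup∘tabulate (λ i → Vec.tabulate (colour i)) i))
    (lookup∘tabulate (colour i) j)

  red⇒≢ : ∀ i j → entry colouring i j ≡ red → i ≢ a × j ≢ b
  red⇒≢ i j eq with i ≟ a | j ≟ b | trans (sym (entry-colouring i j)) eq
  ... | no i≢a | no j≢b | _ = i≢a , j≢b
  ... | no _   | yes _  | ()
  ... | yes _  | _      | ()

  blue⇒≡ : ∀ i j → entry colouring i j ≡ blue → i ≡ a ⊎ j ≡ b
  blue⇒≡ i j eq with i ≟ a | j ≟ b | trans (sym (entry-colouring i j)) eq
  ... | yes i≡a | _       | _ = inj₁ i≡a
  ... | no _    | yes j≡b | _ = inj₂ j≡b
  ... | no _    | no _    | ()

  -- Allowing any non-neighbour `j` of `a` treats the pairs `a`, `b` and `a`, `j` together. No red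
  -- edge meets `a`, so `a` alone is closed in red. In blue, `a` with its neighbours in `G` is
  -- closed: a blue edge at a neighbour `k` of `a` ends at `a`, since otherwise `k` is `b`, which is
  -- not adjacent to `a`.
  ¬share-a : ∀ {H} → IsMonochromaticTree G colouring H → ¬ HasEdge G a b →
    ∀ j → ¬ HasEdge G a j → ¬ (inj₁ a ∈ᵛ H × inj₂ j ∈ᵛ H)
  ¬share-a {H} tree a≁b j a≁j (a∈H , j∈H) with tree
  ... | _ , (_ , connected , _) , red , mono
    with () ← connected-closed {P = inj₁ a ≡_} connected
         (λ { _ (inj₂ k) refl e → contradiction refl (proj₁ (red⇒≢ a k (mono a k e))) })
         (inj₁ a) (inj₂ j) a∈H j∈H refl
  ... | G⊇H , (_ , connected , _) , blue , mono =
    a≁j (connected-closed {P = P} connected closed (inj₁ a) (inj₂ j) a∈H j∈H refl)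
    where
    P : Vertex n m → Set
    P (inj₁ i) = i ≡ a
    P (inj₂ k) = HasEdge G a k
    closed : Closed H P
    closed (inj₁ _) (inj₂ k) refl e = let e′ , _ = G⊇H a k e in e′
    closed (inj₂ k) (inj₁ i) a~k e with blue⇒≡ i k (mono i k e)
    ... | inj₁ i≡a  = i≡a
    ... | inj₂ refl = contradiction a~k a≁b

  -- In red, `b` is isolated. In blue, `j` is isolated, since its edge could only end at the
  -- non-neighbour `a`; the path is therefore followed from `j` to `b` in this case.
  ¬share-b : ∀ {H} → IsMonochromaticTree G colouring H → ¬ HasEdge G a b →
    ∀ j → j ≢ b → ¬ HasEdge G a j → ¬ (inj₂ b ∈ᵛ H × inj₂ j ∈ᵛ H)
  ¬share-b {H} tree a≁b j j≢b a≁j (b∈H , j∈H) with tree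
  ... | _ , (_ , connected , _) , red , mono =
    j≢b (sym (inj₂-injective (connected-closed {P = inj₂ b ≡_} connected
      (λ { _ (inj₁ i) refl e → contradiction refl (proj₂ (red⇒≢ i b (mono i b e))) })
      (inj₂ b) (inj₂ j) b∈H j∈H refl)))
  ... | G⊇H , (_ , connected , _) , blue , mono =
    j≢b (inj₂-injective (connected-closed {P = inj₂ j ≡_} connected closed (inj₂ j) (inj₂ b) j∈H b∈H refl))
    where
    closed : Closed H (inj₂ j ≡_)
    closed _ (inj₁ i) refl e with blue⇒≡ i j (mono i j e)
    ... | inj₂ j≡b  = contradiction j≡b j≢b
    ... | inj₁ refl = let e′ , _ = G⊇H a j e in contradiction e′ a≁j

¬coverable₂ : ∀ {n m} (G : Graph n m) a b j → j ≢ b → ¬ HasEdge G a b → ¬ HasEdge G a j → ¬ Coverable G 2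
¬coverable₂ G a b j j≢b a≁b a≁j coverable =
  let Ts , short , trees , covers = coverable (colouring G a b) in
  contradiction
    (All.lookupAny trees (two-share short (covers (inj₁ a)) (covers (inj₂ b)) (covers (inj₂ j))))
    λ where
      (tree , inj₁ ab)        → ¬share-a G a b tree a≁b b a≁b ab
      (tree , inj₂ (inj₁ aj)) → ¬share-a G a b tree a≁b j a≁j aj
      (tree , inj₂ (inj₂ bj)) → ¬share-b G a b tree a≁b j j≢b a≁j bj

¬coverable₂⇒3≤tc₂ : ∀ {n m} (G : Graph n m) → ¬ Coverable G 2 → 3 ≤ tc₂ G
¬coverable₂⇒3≤tc₂ G ¬cov = ℕ.≰⇒> λ tc₂≤2 → ¬cov λ χ →
  let Ts , short , cover = tc₂-coverable G χ in Ts , ℕ.≤-trans short tc₂≤2 , cover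

-- Bernoulli weights with rational p

∑ℚ : List ℚ → ℚ
∑ℚ = List.foldr ℚ._+_ 0ℚ

∏ℚ : ∀ {n} → Vec ℚ n → ℚ
∏ℚ = Vec.foldr′ ℚ._*_ 1ℚ

0≤p*q : ∀ {p q} → 0ℚ ℚ.≤ p → 0ℚ ℚ.≤ q → 0ℚ ℚ.≤ p ℚ.* q
0≤p*q {p} {q} 0≤p 0≤q = ℚ.nonNegative⁻¹ (p ℚ.* q)
  {{ℚ.nonNeg*nonNeg⇒nonNeg p {{ℚ.nonNegative 0≤p}} q {{ℚ.nonNegative 0≤q}}}}

0≤p+q : ∀ {p q} → 0ℚ ℚ.≤ p → 0ℚ ℚ.≤ q → 0ℚ ℚ.≤ p ℚ.+ q
0≤p+q = ℚ.+-mono-≤ {0ℚ} {_} {0ℚ}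

p≤q⇒0≤q-p : ∀ {p q} → p ℚ.≤ q → 0ℚ ℚ.≤ q ℚ.- p
p≤q⇒0≤q-p {p} {q} p≤q = subst (ℚ._≤ q ℚ.- p) (ℚ.+-inverseʳ p) (ℚ.+-monoˡ-≤ (ℚ.- p) p≤q)

0≤q-p⇒p≤q : ∀ {p q} → 0ℚ ℚ.≤ q ℚ.- p → p ℚ.≤ q
0≤q-p⇒p≤q {p} {q} 0≤ = subst₂ ℚ._≤_ (ℚ.+-identityˡ p)
  (solve 2 (λ p q → q :- p :+ p := q) refl p q) (ℚ.+-monoˡ-≤ p 0≤)

p≤p+q : ∀ p {q} → 0ℚ ℚ.≤ q → p ℚ.≤ p ℚ.+ q
p≤p+q p {q} 0≤q = subst (ℚ._≤ p ℚ.+ q) (ℚ.+-identityʳ p) (ℚ.+-monoʳ-≤ p 0≤q)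

p≤q+p : ∀ {p q} → 0ℚ ℚ.≤ q → p ℚ.≤ q ℚ.+ p
p≤q+p {p} {q} 0≤q = subst (ℚ._≤ q ℚ.+ p) (ℚ.+-identityˡ p) (ℚ.+-monoˡ-≤ p 0≤q)

*-monoˡ-≤ : ∀ {p q r} → 0ℚ ℚ.≤ r → p ℚ.≤ q → r ℚ.* p ℚ.≤ r ℚ.* q
*-monoˡ-≤ {r = r} 0≤r = ℚ.*-monoˡ-≤-nonNeg r {{ℚ.nonNegative 0≤r}}

∑-++ : ∀ xs ys → ∑ℚ (xs ++ ys) ≡ ∑ℚ xs ℚ.+ ∑ℚ ys
∑-++ []       ys = sym (ℚ.+-identityˡ (∑ℚ ys))
∑-++ (x ∷ xs) ys = trans (cong (x ℚ.+_) (∑-++ xs ys)) (sym (ℚ.+-assoc x (∑ℚ xs) (∑ℚ ys)))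

∑-cartesianProductWith : ∀ {A B C : Set} (c : A → B → C) {f : A → ℚ} {g : B → ℚ} {h : C → ℚ} →
  (∀ a b → h (c a b) ≡ f a ℚ.* g b) → ∀ xs ys →
  ∑ℚ (List.map h (cartesianProductWith c xs ys)) ≡ ∑ℚ (List.map f xs) ℚ.* ∑ℚ (List.map g ys)
∑-cartesianProductWith c {g = g} h≡ [] ys = sym (ℚ.*-zeroˡ (∑ℚ (List.map g ys)))
∑-cartesianProductWith c {f} {g} {h} h≡ (x ∷ xs) ys = begin
  ∑ℚ (List.map h (List.map (c x) ys ++ cartesianProductWith c xs ys))
    ≡⟨ cong ∑ℚ (map-++ h (List.map (c x) ys) (cartesianProductWith c xs ys)) ⟩
  ∑ℚ (List.map h (List.map (c x) ys) ++ List.map h (cartesianProductWith c xs ys))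
    ≡⟨ ∑-++ (List.map h (List.map (c x) ys)) _ ⟩
  ∑ℚ (List.map h (List.map (c x) ys)) ℚ.+ ∑ℚ (List.map h (cartesianProductWith c xs ys))
    ≡⟨ cong₂ ℚ._+_ (scaled ys) (∑-cartesianProductWith c h≡ xs ys) ⟩
  f x ℚ.* ∑ℚ (List.map g ys) ℚ.+ ∑ℚ (List.map f xs) ℚ.* ∑ℚ (List.map g ys)
    ≡⟨ ℚ.*-distribʳ-+ (∑ℚ (List.map g ys)) (f x) _ ⟨
  (f x ℚ.+ ∑ℚ (List.map f xs)) ℚ.* ∑ℚ (List.map g ys) ∎
  where
  open ≡-Reasoning
  scaled : ∀ ys → ∑ℚ (List.map h (List.map (c x) ys)) ≡ f x ℚ.* ∑ℚ (List.map g ys)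
  scaled []       = sym (ℚ.*-zeroʳ (f x))
  scaled (y ∷ ys) = trans (cong₂ ℚ._+_ (h≡ x y) (scaled ys)) (sym (ℚ.*-distribˡ-+ (f x) (g y) _))

-- Distributivity, which expresses independence: it is applied to the entries of a row and again to
-- the rows of a graph. The vector `bs` gives each coordinate its own weight function, as forced
-- positions require.
∑-∏ : ∀ {A B : Set} (f : B → A → ℚ) xs {n} (bs : Vec B n) →
  ∑ℚ (List.map (λ v → ∏ℚ (zipWith f bs v)) (vectors xs n))
    ≡ ∏ℚ (Vec.map (λ b → ∑ℚ (List.map (f b) xs)) bs)
∑-∏ f xs []       = refl
∑-∏ f xs {suc n} (b ∷ bs) = trans
  (∑-cartesianProductWith _∷_ {f b} {λ v → ∏ℚ (zipWith f bs v)} (λ _ _ → refl) xs (vectors xs n))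
  (cong (∑ℚ (List.map (f b) xs) ℚ.*_) (∑-∏ f xs bs))

∏-cong : ∀ {A : Set} {f g : A → ℚ} → (∀ a → f a ≡ g a) → ∀ {n} (v : Vec A n) →
  ∏ℚ (Vec.map f v) ≡ ∏ℚ (Vec.map g v)
∏-cong f≡g v = cong ∏ℚ (map-cong f≡g v)

∏-nonNeg : ∀ {A B : Set} {f : A → B → ℚ} → (∀ a b → 0ℚ ℚ.≤ f a b) →
  ∀ {n} (v : Vec A n) w → 0ℚ ℚ.≤ ∏ℚ (zipWith f v w)
∏-nonNeg 0≤f []      []      = ℚ.nonNegative⁻¹ 1ℚ
∏-nonNeg 0≤f (a ∷ v) (b ∷ w) = 0≤p*q (0≤f a b) (∏-nonNeg 0≤f v w)

-- A union bound in terms of weights: outside `A` the weight `w` equals `u` or `v`, hence is at most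
-- their sum. The two bad events enter only through `u` and `v`, summed over all of `xs`.
∑-cover : ∀ {X : Set} {A : X → Set} (A? : Decidable A) {w u v : X → ℚ} →
  (∀ x → 0ℚ ℚ.≤ u x) → (∀ x → 0ℚ ℚ.≤ v x) →
  (∀ x → A x ⊎ w x ≡ u x ⊎ w x ≡ v x) → ∀ xs →
  ∑ℚ (List.map w xs)
    ℚ.≤ ∑ℚ (List.map w (filter A? xs)) ℚ.+ (∑ℚ (List.map u xs) ℚ.+ ∑ℚ (List.map v xs))
∑-cover A? 0≤u 0≤v cover [] = ℚ.≤-refl
∑-cover A? {w} {u} {v} 0≤u 0≤v cover (x ∷ xs)
  with ih ← ∑-cover A? 0≤u 0≤v cover xs with A? x
... | yes _ = begin
  w x ℚ.+ ∑ℚ (List.map w xs)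
    ≤⟨ ℚ.+-monoʳ-≤ (w x) ih ⟩
  w x ℚ.+ (a ℚ.+ (b ℚ.+ c))
    ≤⟨ p≤p+q _ (0≤p+q (0≤u x) (0≤v x)) ⟩
  w x ℚ.+ (a ℚ.+ (b ℚ.+ c)) ℚ.+ (u x ℚ.+ v x)
    ≡⟨ solve 6 (λ w u v a b c → w :+ (a :+ (b :+ c)) :+ (u :+ v) := (w :+ a) :+ ((u :+ b) :+ (v :+ c))) refl
         (w x) (u x) (v x) a b c ⟩
  (w x ℚ.+ a) ℚ.+ ((u x ℚ.+ b) ℚ.+ (v x ℚ.+ c)) ∎
  where
  open ℚ.≤-Reasoning
  a = ∑ℚ (List.map w (filter A? xs))
  b = ∑ℚ (List.map u xs)
  c = ∑ℚ (List.map v xs)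
... | no ¬Ax = begin
  w x ℚ.+ ∑ℚ (List.map w xs)
    ≤⟨ ℚ.+-mono-≤ w≤u+v ih ⟩
  (u x ℚ.+ v x) ℚ.+ (a ℚ.+ (b ℚ.+ c))
    ≡⟨ solve 5 (λ u v a b c → (u :+ v) :+ (a :+ (b :+ c)) := a :+ ((u :+ b) :+ (v :+ c))) refl
         (u x) (v x) a b c ⟩
  a ℚ.+ ((u x ℚ.+ b) ℚ.+ (v x ℚ.+ c)) ∎
  where
  open ℚ.≤-Reasoning
  a = ∑ℚ (List.map w (filter A? xs))
  b = ∑ℚ (List.map u xs)
  c = ∑ℚ (List.map v xs)
  w≤u+v : w x ℚ.≤ u x ℚ.+ v x
  w≤u+v with cover x
  ... | inj₁ Ax        = contradiction Ax ¬Ax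
  ... | inj₂ (inj₁ eq) = ℚ.≤-trans (ℚ.≤-reflexive eq) (p≤p+q (u x) (0≤v x))
  ... | inj₂ (inj₂ eq) = ℚ.≤-trans (ℚ.≤-reflexive eq) (p≤q+p (0≤u x))

-- A forced position gives weight 0 to a missing edge, so that the total weight of all graphs is
-- the probability that all forced edges are present.
cellWeight : ℚ → Bool → Bool → ℚ
cellWeight t forced e = if e then t else (if forced then 0ℚ else 1ℚ ℚ.- t)

rowWeight : ∀ {m} → ℚ → Subset m → Vec Bool m → ℚ
rowWeight t S row = ∏ℚ (zipWith (cellWeight t) S row)

graphWeight : ∀ {n m} → ℚ → Vec (Subset m) n → Graph n m → ℚ
graphWeight t Ss G = ∏ℚ (zipWith (rowWeight t) Ss G)

-- This is t^|S|, kept as a product along `S` so that `∑-∏` produces it without rearrangement.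
fullProb : ∀ {m} → ℚ → Subset m → ℚ
fullProb t S = ∏ℚ (Vec.map (λ forced → if forced then t else 1ℚ) S)

bools : List Bool
bools = false ∷ true ∷ []

∑-rowWeight : ∀ t {m} (S : Subset m) →
  ∑ℚ (List.map (rowWeight t S) (vectors bools m)) ≡ fullProb t S
∑-rowWeight t S = trans (∑-∏ (cellWeight t) bools S) (∏-cong cells S)
  where
  cells : ∀ forced → ∑ℚ (List.map (cellWeight t forced) bools) ≡ (if forced then t else 1ℚ)
  cells true  = trans (ℚ.+-identityˡ (t ℚ.+ 0ℚ)) (ℚ.+-identityʳ t)
  cells false = solve 1 (λ t → (con 1ℚ :- t) :+ (t :+ con 0ℚ) := con 1ℚ) refl t

fullProb-∅ : ∀ t m → fullProb t (∅ {m}) ≡ 1ℚ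
fullProb-∅ t zero    = refl
fullProb-∅ t (suc m) = trans (ℚ.*-identityˡ (fullProb t (∅ {m}))) (fullProb-∅ t m)

∏-fullProb-∅ : ∀ t n m → ∏ℚ (Vec.map (fullProb t) (replicate n (∅ {m}))) ≡ 1ℚ
∏-fullProb-∅ t zero    m = refl
∏-fullProb-∅ t (suc n) m = cong₂ ℚ._*_ (fullProb-∅ t m) (∏-fullProb-∅ t n m)

∑-graphWeight : ∀ t {n m} (S : Subset m) →
  ∑ℚ (List.map (graphWeight t (S ∷ replicate n ∅)) (graphs (suc n) m)) ≡ fullProb t S
∑-graphWeight t {n} {m} S = begin
  ∑ℚ (List.map (graphWeight t (S ∷ replicate n ∅)) (graphs (suc n) m))
    ≡⟨ ∑-∏ (rowWeight t) (vectors bools m) (S ∷ replicate n ∅) ⟩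
  ∏ℚ (Vec.map (λ S → ∑ℚ (List.map (rowWeight t S) (vectors bools m))) (S ∷ replicate n ∅))
    ≡⟨ ∏-cong (∑-rowWeight t) (S ∷ replicate n ∅) ⟩
  fullProb t S ℚ.* ∏ℚ (Vec.map (fullProb t) (replicate n ∅))
    ≡⟨ cong (fullProb t S ℚ.*_) (∏-fullProb-∅ t n m) ⟩
  fullProb t S ℚ.* 1ℚ
    ≡⟨ ℚ.*-identityʳ (fullProb t S) ⟩
  fullProb t S ∎
  where open ≡-Reasoning

-- Forcing changes only the weight of a missing edge inside `S`. Expressing fullness on `S` by an
-- equality of weights turns this event into a sum over all graphs, which factorises.
missing-or-full : ∀ t {m} (S : Subset m) (row : Vec Bool m) →
  (∃[ j ] (j ∈ˢ S × ¬ Vec.lookup row j ≡ true)) ⊎ rowWeight t ∅ row ≡ rowWeight t S row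
missing-or-full t []          []            = inj₂ refl
missing-or-full t (true  ∷ S) (false ∷ row) = inj₁ (zero , here , λ ())
missing-or-full t (true  ∷ S) (true  ∷ row) with missing-or-full t S row
... | inj₁ (j , j∈S , missing) = inj₁ (suc j , there j∈S , missing)
... | inj₂ eq                  = inj₂ (cong (t ℚ.*_) eq)
missing-or-full t (false ∷ S) (e ∷ row) with missing-or-full t S row
... | inj₁ (j , j∈S , missing) = inj₁ (suc j , there j∈S , missing)
... | inj₂ eq                  = inj₂ (cong (cellWeight t false e ℚ.*_) eq)

module _ {t : ℚ} (0≤t : 0ℚ ℚ.≤ t) (t≤1 : t ℚ.≤ 1ℚ) where

  cellWeight-nonNeg : ∀ forced e → 0ℚ ℚ.≤ cellWeight t forced e
  cellWeight-nonNeg _     true  = 0≤t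
  cellWeight-nonNeg true  false = ℚ.≤-refl
  cellWeight-nonNeg false false = p≤q⇒0≤q-p t≤1

  graphWeight-nonNeg : ∀ {n m} (Ss : Vec (Subset m) n) G → 0ℚ ℚ.≤ graphWeight t Ss G
  graphWeight-nonNeg = ∏-nonNeg (∏-nonNeg cellWeight-nonNeg)

  -- With nothing forced the total weight is 1, and `∑-cover` splits it by the first row. A row full
  -- on neither `S` nor its complement misses an entry in each, and these are distinct because the
  -- two sets are disjoint.
  two-missing-prob : ∀ {n m} {A : Graph (suc n) m → Set} (A? : Decidable A) (S : Subset m) →
    (∀ G j j′ → j ≢ j′ → ¬ HasEdge G zero j → ¬ HasEdge G zero j′ → A G) →
    1ℚ ℚ.≤ ∑ℚ (List.map (graphWeight t (replicate (suc n) ∅)) (filter A? (graphs (suc n) m)))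
      ℚ.+ (fullProb t S ℚ.+ fullProb t (∁ S))
  two-missing-prob {n} {m} {A} A? S missing⇒A = subst₂ ℚ._≤_
    (trans (∑-graphWeight t {n} {m} ∅) (fullProb-∅ t m))
    (cong₂ (λ x y → ∑ℚ (List.map (graphWeight t (replicate (suc n) ∅)) (filter A? (graphs (suc n) m))) ℚ.+ (x ℚ.+ y))
      (∑-graphWeight t S) (∑-graphWeight t (∁ S)))
    (∑-cover A? (graphWeight-nonNeg (S ∷ replicate n ∅)) (graphWeight-nonNeg (∁ S ∷ replicate n ∅))
      cover (graphs (suc n) m))
    where
    cover : ∀ G → A G
      ⊎ graphWeight t (replicate (suc n) ∅) G ≡ graphWeight t (S ∷ replicate n ∅) G
      ⊎ graphWeight t (replicate (suc n) ∅) G ≡ graphWeight t (∁ S ∷ replicate n ∅) G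
    cover G@(row ∷ rows) with missing-or-full t S row | missing-or-full t (∁ S) row
    ... | inj₂ eq | _ = inj₂ (inj₁ (cong (ℚ._* graphWeight t (replicate n ∅) rows) eq))
    ... | inj₁ _  | inj₂ eq = inj₂ (inj₂ (cong (ℚ._* graphWeight t (replicate n ∅) rows) eq))
    ... | inj₁ (j , j∈S , ¬j) | inj₁ (j′ , j′∈∁S , ¬j′) = inj₁ (missing⇒A G j j′
      (λ j≡j′ → x∈p⇒x∉∁p j∈S (subst (_∈ˢ ∁ S) (sym j≡j′) j′∈∁S)) ¬j ¬j′)

-- Lower bound for the logarithm

copies-nonNeg : ∀ k {q} → 0ℚ ℚ.≤ q → 0ℚ ℚ.≤ copies k q
copies-nonNeg zero    0≤q = ℚ.≤-refl
copies-nonNeg (suc k) 0≤q = 0≤p+q 0≤q (copies-nonNeg k 0≤q)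

copies-monoˡ : ∀ {k l q} → 0ℚ ℚ.≤ q → k ℕ.≤ l → copies k q ℚ.≤ copies l q
copies-monoˡ {l = l} 0≤q z≤n = copies-nonNeg l 0≤q
copies-monoˡ {q = q} 0≤q (s≤s k≤l) = ℚ.+-monoʳ-≤ q (copies-monoˡ 0≤q k≤l)

copies-+ : ∀ k l q → copies (k ℕ.+ l) q ≡ copies k q ℚ.+ copies l q
copies-+ zero    l q = sym (ℚ.+-identityˡ (copies l q))
copies-+ (suc k) l q = trans (cong (q ℚ.+_) (copies-+ k l q)) (sym (ℚ.+-assoc q (copies k q) (copies l q)))

copies-copies : ∀ k l q → copies k (copies l q) ≡ copies (k ℕ.* l) q
copies-copies zero    l q = refl
copies-copies (suc k) l q =
  trans (cong (copies l q ℚ.+_) (copies-copies k l q)) (sym (copies-+ l (k ℕ.* l) q))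

copies-*ʳ : ∀ k p q → copies k (p ℚ.* q) ≡ copies k p ℚ.* q
copies-*ʳ zero    p q = sym (ℚ.*-zeroˡ q)
copies-*ʳ (suc k) p q =
  trans (cong (p ℚ.* q ℚ.+_) (copies-*ʳ k p q)) (sym (ℚ.*-distribʳ-+ q p (copies k p)))

k/n≡copies : ∀ k n → + k / suc n ≡ copies k (r n)
k/n≡copies k n = ℚ.toℚᵘ-injective
  (ℚᵘ.≃-trans (ℚ.toℚᵘ-fromℚᵘ (mkℚᵘ (+ k) n)) (ℚᵘ.≃-sym (copies-≃ k n)))

-- log n ≥ j/2 for n ≥ 2ʲ: each doubling of the range of the harmonic sum adds at least 1/2.
½≤recipSum : ∀ s → r 1 ℚ.≤ recipSum (suc s) (suc s)
½≤recipSum s = subst (ℚ._≤ recipSum (suc s) (suc s)) (copies-r (suc s) 1 N 1+N≡)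
  (recipSum-lower (suc s) (suc s) N (ℕ.≤-refl))
  where
  -- `r N` is 1/(2s + 2), the last and smallest of the s + 1 terms.
  N = s ℕ.+ suc s
  1+N≡ : suc N ≡ 2 ℕ.* suc s
  1+N≡ = cong (suc s ℕ.+_) (sym (ℕ.+-identityʳ (suc s)))

recipSum-mono : ∀ s {k l} → k ℕ.≤ l → recipSum s k ℚ.≤ recipSum s l
recipSum-mono s {l = zero}  z≤n = ℚ.≤-refl
recipSum-mono s {l = suc l} z≤n = 0≤p+q (0≤r s) (recipSum-mono (suc s) {0} {l} z≤n)
recipSum-mono s (s≤s k≤l) = ℚ.+-monoʳ-≤ (r s) (recipSum-mono (suc s) k≤l)

-- This is (2^j - 1)(m + 1), the number of terms that takes the largest denominator from m + 1 to
-- 2^j (m + 1). The recursive form avoids subtraction.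
doublings : ℕ → ℕ → ℕ
doublings m zero    = 0
doublings m (suc j) = doublings m j ℕ.+ suc (doublings m j ℕ.+ m)

1+doublings+m : ∀ m j → suc (doublings m j ℕ.+ m) ≡ 2 ℕ.^ j ℕ.* suc m
1+doublings+m m zero    = sym (ℕ.+-identityʳ (suc m))
1+doublings+m m (suc j) = begin
  suc ((d ℕ.+ suc (d ℕ.+ m)) ℕ.+ m)        ≡⟨ double d m ⟩
  2 ℕ.* suc (d ℕ.+ m)                      ≡⟨ cong (2 ℕ.*_) (1+doublings+m m j) ⟩
  2 ℕ.* (2 ℕ.^ j ℕ.* suc m)                ≡⟨ ℕ.*-assoc 2 (2 ℕ.^ j) (suc m) ⟨
  2 ℕ.^ suc j ℕ.* suc m                    ∎
  where
  open ≡-Reasoning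
  d = doublings m j
  double : ∀ d m → suc ((d ℕ.+ suc (d ℕ.+ m)) ℕ.+ m) ≡ 2 ℕ.* suc (d ℕ.+ m)
  double = solve-∀

recipSum-doublings : ∀ m j → copies j (r 1) ℚ.≤ recipSum (suc m) (doublings m j)
recipSum-doublings m zero    = ℚ.≤-refl
recipSum-doublings m (suc j) = begin
  r 1 ℚ.+ copies j (r 1)
    ≤⟨ ℚ.+-mono-≤ (½≤recipSum (d ℕ.+ m)) (recipSum-doublings m j) ⟩
  recipSum (suc (d ℕ.+ m)) (suc (d ℕ.+ m)) ℚ.+ recipSum (suc m) d
    ≡⟨ ℚ.+-comm (recipSum (suc (d ℕ.+ m)) (suc (d ℕ.+ m))) (recipSum (suc m) d) ⟩
  recipSum (suc m) d ℚ.+ recipSum (suc (d ℕ.+ m)) (suc (d ℕ.+ m))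
    ≡⟨ cong (λ s → recipSum (suc m) d ℚ.+ recipSum s (suc (d ℕ.+ m))) (ℕ.+-suc d m) ⟨
  recipSum (suc m) d ℚ.+ recipSum (d ℕ.+ suc m) (suc (d ℕ.+ m))
    ≡⟨ recipSum-++ (suc m) d (suc (d ℕ.+ m)) ⟨
  recipSum (suc m) (d ℕ.+ suc (d ℕ.+ m)) ∎
  where
  open ℚ.≤-Reasoning
  d = doublings m j

-- The bound holds at every mesh 1/(m + 1), not only in the limit: j doublings of m + 1 stay below n
-- (m + 1). Hence `log` can be replaced by a rational term by term inside `≤ᵣ`.
riemannSum-lower : ∀ j n m → 2 ℕ.^ j ℕ.≤ n → copies j (r 1) ℚ.≤ riemannSum n m
riemannSum-lower j zero    m 2^j≤0 = contradiction 2^j≤0 (ℕ.<⇒≱ (ℕ.m^n>0 2 j))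
riemannSum-lower j (suc n) m 2^j≤n = ℚ.≤-trans (recipSum-doublings m j)
  (recipSum-mono (suc m) (ℕ.+-cancelʳ-≤ (suc m) (doublings m j) (n ℕ.* suc m) (begin
    doublings m j ℕ.+ suc m     ≡⟨ trans (ℕ.+-suc (doublings m j) m) (1+doublings+m m j) ⟩
    2 ℕ.^ j ℕ.* suc m           ≤⟨ ℕ.*-monoˡ-≤ (suc m) 2^j≤n ⟩
    suc m ℕ.+ n ℕ.* suc m       ≡⟨ ℕ.+-comm (suc m) (n ℕ.* suc m) ⟩
    n ℕ.* suc m ℕ.+ suc m       ∎)))
  where open ℕ.≤-Reasoning

-- Bernoulli's inequality for full rows

fullProb-nonNeg : ∀ {t} → 0ℚ ℚ.≤ t → ∀ {m} (S : Subset m) → 0ℚ ℚ.≤ fullProb t S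
fullProb-nonNeg 0≤t []          = ℚ.nonNegative⁻¹ 1ℚ
fullProb-nonNeg 0≤t (true  ∷ S) = 0≤p*q 0≤t (fullProb-nonNeg 0≤t S)
fullProb-nonNeg 0≤t (false ∷ S) = 0≤p*q (ℚ.nonNegative⁻¹ 1ℚ) (fullProb-nonNeg 0≤t S)

-- Multiplied out to avoid division, with `c` a lower bound for 1 - t.
fullProb-bernoulli : ∀ {t c} → 0ℚ ℚ.≤ t → 0ℚ ℚ.≤ c → t ℚ.≤ 1ℚ ℚ.- c → ∀ {m} (S : Subset m) →
  fullProb t S ℚ.* (1ℚ ℚ.+ copies (size S) c) ℚ.≤ 1ℚ
fullProb-bernoulli 0≤t 0≤c t≤1-c [] = ℚ.≤-refl
fullProb-bernoulli {t} {c} 0≤t 0≤c t≤1-c (false ∷ S) =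
  subst (λ x → x ℚ.* (1ℚ ℚ.+ copies (size S) c) ℚ.≤ 1ℚ) (sym (ℚ.*-identityˡ (fullProb t S)))
    (fullProb-bernoulli 0≤t 0≤c t≤1-c S)
fullProb-bernoulli {t} {c} 0≤t 0≤c t≤1-c (true ∷ S) = 0≤q-p⇒p≤q (subst (0ℚ ℚ.≤_)
  -- Three nonnegative summands: the induction hypothesis, the slack in t ≤ 1 - c, and P times the
  -- difference (1 + K) - (1 - c)(1 + c + K) = c (c + K).
  (solve 4 (λ t c P K →
     (con 1ℚ :- P :* (con 1ℚ :+ K))
       :+ ((con 1ℚ :- c :- t) :* (P :* (con 1ℚ :+ (c :+ K))) :+ (c :* (c :+ K)) :* P)
     := con 1ℚ :- t :* P :* (con 1ℚ :+ (c :+ K)))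
   refl t c P K)
  (0≤p+q (p≤q⇒0≤q-p (fullProb-bernoulli 0≤t 0≤c t≤1-c S))
    (0≤p+q
      (0≤p*q (p≤q⇒0≤q-p t≤1-c) (0≤p*q 0≤P (0≤p+q (ℚ.nonNegative⁻¹ 1ℚ) 0≤c+K)))
      (0≤p*q (0≤p*q 0≤c 0≤c+K) 0≤P))))
  where
  P = fullProb t S
  K = copies (size S) c
  0≤P = fullProb-nonNeg 0≤t S
  0≤c+K = copies-nonNeg (suc (size S)) 0≤c

-- Bernoulli's inequality gives P d ≤ P (1 + |S| c) ≤ 1, hence P ≤ 1/d; the reciprocal is passed as
-- `δ`.
fullProb-upper : ∀ {t c d δ} → 0ℚ ℚ.≤ t → 0ℚ ℚ.≤ c → 0ℚ ℚ.≤ δ → t ℚ.≤ 1ℚ ℚ.- c → δ ℚ.* d ≡ 1ℚ →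
  ∀ {m} (S : Subset m) → d ℚ.≤ copies (size S) c → fullProb t S ℚ.≤ δ
fullProb-upper {t} {c} {d} {δ} 0≤t 0≤c 0≤δ t≤1-c δd≡1 S d≤ = begin
  P                ≡⟨ ℚ.*-identityˡ P ⟨
  1ℚ ℚ.* P         ≡⟨ cong (ℚ._* P) δd≡1 ⟨
  δ ℚ.* d ℚ.* P    ≡⟨ trans (ℚ.*-assoc δ d P) (cong (δ ℚ.*_) (ℚ.*-comm d P)) ⟩
  δ ℚ.* (P ℚ.* d)  ≤⟨ *-monoˡ-≤ 0≤δ (ℚ.≤-trans (*-monoˡ-≤ (fullProb-nonNeg 0≤t S) d≤1+K) (fullProb-bernoulli 0≤t 0≤c t≤1-c S)) ⟩
  δ ℚ.* 1ℚ         ≡⟨ ℚ.*-identityʳ δ ⟩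
  δ                ∎
  where
  open ℚ.≤-Reasoning
  P = fullProb t S
  d≤1+K : d ℚ.≤ 1ℚ ℚ.+ copies (size S) c
  d≤1+K = ℚ.≤-trans d≤ (p≤q+p (ℚ.nonNegative⁻¹ 1ℚ))

-- The constant 3 in the bound on p enters here: a set with at least a third of the columns
-- satisfies |S| · 3/n ≥ 1.
d≤copies : ∀ k n {d} → suc n ℕ.≤ k ℕ.* 3 → 0ℚ ℚ.≤ d → d ℚ.≤ copies k (+ 3 / suc n ℚ.* d)
d≤copies k n {d} n<k*3 0≤d = begin
  d                               ≡⟨ ℚ.*-identityˡ d ⟨
  1ℚ ℚ.* d                        ≤⟨ ℚ.*-monoʳ-≤-nonNeg d {{ℚ.nonNegative 0≤d}} 1≤ ⟩
  copies k (+ 3 / suc n) ℚ.* d    ≡⟨ copies-*ʳ k (+ 3 / suc n) d ⟨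
  copies k (+ 3 / suc n ℚ.* d)    ∎
  where
  open ℚ.≤-Reasoning
  1≤ : 1ℚ ℚ.≤ copies k (+ 3 / suc n)
  1≤ = begin
    1ℚ                       ≡⟨ copies-r (suc n) 0 n (sym (ℕ.*-identityˡ (suc n))) ⟨
    copies (suc n) (r n)     ≤⟨ copies-monoˡ (0≤r n) n<k*3 ⟩
    copies (k ℕ.* 3) (r n)   ≡⟨ copies-copies k 3 (r n) ⟨
    copies k (copies 3 (r n)) ≡⟨ cong (copies k) (k/n≡copies 3 n) ⟨
    copies k (+ 3 / suc n)   ∎

-- A balanced splitting of the columns

alternating : ∀ n → Subset n
alternating zero          = []
alternating (suc zero)    = true ∷ []
alternating (suc (suc n)) = true ∷ false ∷ alternating n

-- The added 1 allows for n = 1, where the complement is empty. Once there are two columns it is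
-- absorbed: the first two lie in different classes, so each threefold size gains 3 for 2 columns.
size-alternating : ∀ n → n ℕ.≤ suc (size (alternating n) ℕ.* 3)
size-alternating zero          = z≤n
size-alternating (suc zero)    = s≤s z≤n
size-alternating (suc (suc n)) = s≤s (s≤s (ℕ.m≤n⇒m≤1+n (size-alternating n)))

size-∁-alternating : ∀ n → n ℕ.≤ suc (size (∁ (alternating n)) ℕ.* 3)
size-∁-alternating zero          = z≤n
size-∁-alternating (suc zero)    = s≤s z≤n
size-∁-alternating (suc (suc n)) = s≤s (s≤s (ℕ.m≤n⇒m≤1+n (size-∁-alternating n)))

-- Here 2(N + 1) halves make N + 1, the lower bound used for the logarithm, and `r N` is its
-- reciprocal.
r*copies≡1 : ∀ N → r N ℚ.* copies (suc N ℕ.* 2) (r 1) ≡ 1ℚ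
r*copies≡1 N = begin
  r N ℚ.* copies (suc N ℕ.* 2) (r 1)
    ≡⟨ cong (r N ℚ.*_) (copies-copies (suc N) 2 (r 1)) ⟨
  r N ℚ.* copies (suc N) 1ℚ
    ≡⟨ ℚ.*-comm (r N) (copies (suc N) 1ℚ) ⟩
  copies (suc N) 1ℚ ℚ.* r N
    ≡⟨ copies-*ʳ (suc N) 1ℚ (r N) ⟨
  copies (suc N) (1ℚ ℚ.* r N)
    ≡⟨ cong (copies (suc N)) (ℚ.*-identityˡ (r N)) ⟩
  copies (suc N) (r N)
    ≡⟨ copies-r (suc N) 0 N (sym (ℕ.*-identityˡ (suc N))) ⟩
  1ℚ ∎
  where open ≡-Reasoning

-- From rational to real p

infix 4 _tracks_

-- The rational sequence s need not be the one given with the real number x, but has the same limit.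
_tracks_ : (ℕ → ℚ) → ℝ → Set
s tracks x = ∀ ε → 0ℚ ℚ.< ε → ∃[ N ] (∀ k → N ℕ.≤ k → ∣ seq x k ℚ.- s k ∣ ℚ.≤ ε)

const-tracks : ∀ q → (λ _ → q) tracks fromℚ q
const-tracks q ε 0<ε = 0 , λ _ _ →
  subst (λ z → ∣ z ∣ ℚ.≤ ε) (sym (ℚ.+-inverseʳ q)) (ℚ.<⇒≤ 0<ε)

+-tracks : ∀ x y {s u} → s tracks x → u tracks y → (λ k → s k ℚ.+ u k) tracks (x +ᵣ y)
+-tracks x y {s} {u} sx uy ε 0<ε =
  let
    δ , 0<δ , δ+δ≡ε = half ε 0<ε
    M , sx′ = sx δ 0<δ
    N , uy′ = uy δ 0<δ
  in M ℕ.⊔ N , λ k k≥ → let open ℚ.≤-Reasoning in begin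
    ∣ (seq x k ℚ.+ seq y k) ℚ.- (s k ℚ.+ u k) ∣
      ≡⟨ cong ∣_∣ (solve 4 (λ a b c d → (a :+ b) :- (c :+ d) := (a :- c) :+ (b :- d))
                    refl (seq x k) (seq y k) (s k) (u k)) ⟩
    ∣ (seq x k ℚ.- s k) ℚ.+ (seq y k ℚ.- u k) ∣
      ≤⟨ ℚ.∣p+q∣≤∣p∣+∣q∣ (seq x k ℚ.- s k) (seq y k ℚ.- u k) ⟩
    ∣ seq x k ℚ.- s k ∣ ℚ.+ ∣ seq y k ℚ.- u k ∣
      ≤⟨ ℚ.+-mono-≤ (sx′ k (ℕ.m⊔n≤o⇒m≤o M N k≥)) (uy′ k (ℕ.m⊔n≤o⇒n≤o M N k≥)) ⟩
    δ ℚ.+ δ ≡⟨ δ+δ≡ε ⟩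
    ε ∎

1-tracks : ∀ x {s} → s tracks x → (λ k → 1ℚ ℚ.- s k) tracks (1ℝ -ᵣ x)
1-tracks x {s} sx ε 0<ε = let N , sx′ = sx ε 0<ε in N , λ k k≥ →
  subst (ℚ._≤ ε)
    (trans (sym (ℚ.∣-p∣≡∣p∣ (seq x k ℚ.- s k)))
      (cong ∣_∣ (solve 2 (λ a b → :- (a :- b) := (con 1ℚ :- a) :- (con 1ℚ :- b)) refl (seq x k) (s k))))
    (sx′ k k≥)

tracks-bounded : ∀ x {s} → s tracks x →
  ∃[ B ] ∃[ N ] (ℚ.Positive B × (∀ k → N ℕ.≤ k → ∣ s k ∣ ℚ.≤ B))
tracks-bounded x {s} sx =
  let
    B , M , B>0 , x≤B = bounded {seq x} (cauchy x)
    N , sx′ = sx 1ℚ (ℚ.positive⁻¹ 1ℚ)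
  in B ℚ.+ 1ℚ , M ℕ.⊔ N , ℚ.pos+pos⇒pos B {{B>0}} 1ℚ , λ k k≥ → let open ℚ.≤-Reasoning in begin
    ∣ s k ∣
      ≡⟨ cong ∣_∣ (solve 2 (λ a b → b := a :- (a :- b)) refl (seq x k) (s k)) ⟩
    ∣ seq x k ℚ.- (seq x k ℚ.- s k) ∣
      ≤⟨ ℚ.∣p-q∣≤∣p∣+∣q∣ (seq x k) (seq x k ℚ.- s k) ⟩
    ∣ seq x k ∣ ℚ.+ ∣ seq x k ℚ.- s k ∣
      ≤⟨ ℚ.+-mono-≤ (x≤B k (ℕ.m⊔n≤o⇒m≤o M N k≥)) (sx′ k (ℕ.m⊔n≤o⇒n≤o M N k≥)) ⟩
    B ℚ.+ 1ℚ ∎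

*-tracks : ∀ x y {s u} → s tracks x → u tracks y → (λ k → s k ℚ.* u k) tracks (x *ᵣ y)
*-tracks x y {s} {u} sx uy ε 0<ε =
  let
    A , M₁ , A>0 , x≤A = bounded {seq x} (cauchy x)
    B , M₂ , B>0 , u≤B = tracks-bounded y uy
    δ , 0<δ , eq = divide (A ℚ.+ B) ε (ℚ.pos+pos⇒pos A {{A>0}} B {{B>0}}) 0<ε
    N₁ , sx′ = sx δ 0<δ
    N₂ , uy′ = uy δ 0<δ
  in (M₁ ℕ.⊔ M₂) ℕ.⊔ (N₁ ℕ.⊔ N₂) , λ k k≥ →
    let
      M≤k = ℕ.m⊔n≤o⇒m≤o (M₁ ℕ.⊔ M₂) _ k≥
      N≤k = ℕ.m⊔n≤o⇒n≤o (M₁ ℕ.⊔ M₂) _ k≥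
    in subst (∣ seq x k ℚ.* seq y k ℚ.- s k ℚ.* u k ∣ ℚ.≤_) eq
      (*-close (seq x k) (seq y k) (s k) (u k) A>0 B>0
        (x≤A k (ℕ.m⊔n≤o⇒m≤o M₁ M₂ M≤k)) (u≤B k (ℕ.m⊔n≤o⇒n≤o M₁ M₂ M≤k))
        (sx′ k (ℕ.m⊔n≤o⇒m≤o N₁ N₂ N≤k)) (uy′ k (ℕ.m⊔n≤o⇒n≤o N₁ N₂ N≤k)))

∑-tracks : ∀ {X : Set} (f : X → ℝ) (g : ℕ → X → ℚ) → (∀ a → (λ k → g k a) tracks f a) →
  ∀ xs → (λ k → ∑ℚ (List.map (g k) xs)) tracks ∑ (List.map f xs)
∑-tracks f g gf []       = const-tracks 0ℚ
∑-tracks f g gf (x ∷ xs) = +-tracks (f x) (∑ (List.map f xs)) (gf x) (∑-tracks f g gf xs)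

-- The constant parameter `b` marks every position as unforced: `false` for the entries of a row,
-- then `∅`, a `replicate` of `false`, for the rows.
∏-tracks : ∀ {X B : Set} (f : X → ℝ) (g : ℕ → B → X → ℚ) b → (∀ a → (λ k → g k b a) tracks f a) →
  ∀ {n} (v : Vec X n) → (λ k → ∏ℚ (zipWith (g k) (replicate n b) v)) tracks ∏ (Vec.map f v)
∏-tracks f g b gf []      = const-tracks 1ℚ
∏-tracks f g b gf (x ∷ v) = *-tracks (f x) (∏ (Vec.map f v)) (gf x) (∏-tracks f g b gf v)

weight-tracks : ∀ p {t} → t tracks p → ∀ {n m} (G : Graph n m) →
  (λ k → graphWeight (t k) (replicate n ∅) G) tracks weight p G
weight-tracks p {t} tp =
  ∏-tracks _ (λ k → rowWeight (t k)) ∅ (∏-tracks _ (λ k → cellWeight (t k)) false cell)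
  where
  cell : ∀ e → (λ k → cellWeight (t k) false e) tracks (if e then p else 1ℝ -ᵣ p)
  cell true  = tp
  cell false = 1-tracks p tp

tracks⇒≤ᵣ : ∀ {q s} x → (∀ k → q ℚ.≤ s k) → s tracks x → fromℚ q ≤ᵣ x
tracks⇒≤ᵣ {q} {s} x q≤s sx ε 0<ε = let N , sx′ = sx ε 0<ε in N , λ k k≥ →
  let open ℚ.≤-Reasoning in begin
    q                                              ≤⟨ q≤s k ⟩
    s k                                            ≡⟨ solve 2 (λ a b → b := a :+ :- (a :- b)) refl (seq x k) (s k) ⟩
    seq x k ℚ.+ ℚ.- (seq x k ℚ.- s k)              ≤⟨ ℚ.+-monoʳ-≤ (seq x k) (-p≤∣p∣ (seq x k ℚ.- s k)) ⟩
    seq x k ℚ.+ ∣ seq x k ℚ.- s k ∣                ≤⟨ ℚ.+-monoʳ-≤ (seq x k) (sx′ k k≥) ⟩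
    seq x k ℚ.+ ε                                  ∎
  where
  -p≤∣p∣ : ∀ p → ℚ.- p ℚ.≤ ∣ p ∣
  -p≤∣p∣ p with ℚ.∣p∣≡p∨∣p∣≡-p p
  ... | inj₁ ∣p∣≡p  = ℚ.≤-trans (ℚ.neg-antimono-≤ (subst (0ℚ ℚ.≤_) ∣p∣≡p (ℚ.0≤∣p∣ p))) (ℚ.0≤∣p∣ p)
  ... | inj₂ ∣p∣≡-p = ℚ.≤-reflexive (sym ∣p∣≡-p)

-- Approximation of a real from within an interval

clamp : ℚ → ℚ → ℚ
clamp b p = 0ℚ ℚ.⊔ (b ℚ.⊓ p)

0≤clamp : ∀ b p → 0ℚ ℚ.≤ clamp b p
0≤clamp b p = ℚ.p≤p⊔q 0ℚ (b ℚ.⊓ p)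

clamp≤ : ∀ {b} p → 0ℚ ℚ.≤ b → clamp b p ℚ.≤ b
clamp≤ {b} p 0≤b = ℚ.⊔-lub 0≤b (ℚ.p⊓q≤p b p)

clamp-close : ∀ {b p ε} → 0ℚ ℚ.< ε → 0ℚ ℚ.≤ b → 0ℚ ℚ.≤ p ℚ.+ ε → p ℚ.≤ b ℚ.+ ε → ∣ p ℚ.- clamp b p ∣ ℚ.≤ ε
clamp-close {b} {p} {ε} 0<ε 0≤b 0≤p+ε p≤b+ε with ℚ.≤-total b p
... | inj₁ b≤p rewrite ℚ.p≤q⇒p⊓q≡p b≤p | ℚ.p≤q⇒p⊔q≡q 0≤b = ∣p∣≤
  (0≤q-p⇒p≤q (subst (0ℚ ℚ.≤_) (solve 3 (λ b p ε → b :+ ε :- p := ε :- (p :- b)) refl b p ε) (p≤q⇒0≤q-p p≤b+ε)))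
  (0≤q-p⇒p≤q (subst (0ℚ ℚ.≤_) (solve 3 (λ b p ε → ε :+ (p :- b) := ε :- (:- (p :- b))) refl b p ε) (0≤p+q (ℚ.<⇒≤ 0<ε) (p≤q⇒0≤q-p b≤p))))
... | inj₂ p≤b rewrite ℚ.p≥q⇒p⊓q≡q p≤b with ℚ.≤-total 0ℚ p
...   | inj₁ 0≤p rewrite ℚ.p≤q⇒p⊔q≡q 0≤p =
  subst (λ z → ∣ z ∣ ℚ.≤ ε) (sym (ℚ.+-inverseʳ p)) (ℚ.<⇒≤ 0<ε)
...   | inj₂ p≤0 rewrite ℚ.p≥q⇒p⊔q≡p p≤0 = ∣p∣≤
  (subst (ℚ._≤ ε) (sym (ℚ.+-identityʳ p)) (ℚ.≤-trans p≤0 (ℚ.<⇒≤ 0<ε)))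
  (0≤q-p⇒p≤q (subst (0ℚ ℚ.≤_) (solve 2 (λ p ε → p :+ ε := ε :- (:- (p :- con 0ℚ))) refl p ε) 0≤p+ε))

clamp-tracks : ∀ {b} x → 0ℚ ℚ.≤ b → 0ℝ ≤ᵣ x → x ≤ᵣ fromℚ b → (λ k → clamp b (seq x k)) tracks x
clamp-tracks x 0≤b 0≤x x≤b ε 0<ε =
  let
    M , 0≤x′ = 0≤x ε 0<ε
    N , x≤b′ = x≤b ε 0<ε
  in M ℕ.⊔ N , λ k k≥ →
    clamp-close 0<ε 0≤b (0≤x′ k (ℕ.m⊔n≤o⇒m≤o M N k≥)) (x≤b′ k (ℕ.m⊔n≤o⇒n≤o M N k≥))


-- This makes the clamping interval nonempty: c ≤ 1 follows from the two bounds on p, without an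
-- upper estimate of the logarithm.
0≤ᵣx≤ᵣb⇒0≤b : ∀ {b} x → 0ℝ ≤ᵣ x → x ≤ᵣ fromℚ b → 0ℚ ℚ.≤ b
0≤ᵣx≤ᵣb⇒0≤b {b} x 0≤x x≤b = ℚ.≮⇒≥ λ b<0 →
  let
    -- With ε = -b/2 and δ = -b/4, the two approximate bounds give 0 ≤ b + 2δ = -ε, a contradiction.
    ε , 0<ε , ε+ε≡-b = half (ℚ.- b) (ℚ.neg-antimono-< b<0)
    δ , 0<δ , δ+δ≡ε = half ε 0<ε
    M , 0≤x′ = 0≤x δ 0<δ
    N , x≤b′ = x≤b δ 0<δ
    k = M ℕ.⊔ N
    open ℚ.≤-Reasoning
  in ℚ.<-irrefl refl (ℚ.<-≤-trans 0<ε (0≤q-p⇒p≤q (begin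
    0ℚ                         ≤⟨ 0≤x′ k (ℕ.m≤m⊔n M N) ⟩
    seq x k ℚ.+ δ              ≤⟨ ℚ.+-monoˡ-≤ δ (x≤b′ k (ℕ.m≤n⊔m M N)) ⟩
    b ℚ.+ δ ℚ.+ δ              ≡⟨ solve 2 (λ b δ → b :+ δ :+ δ := δ :+ δ :- :- b) refl b δ ⟩
    δ ℚ.+ δ ℚ.- ℚ.- b          ≡⟨ cong₂ ℚ._-_ δ+δ≡ε (sym ε+ε≡-b) ⟩
    ε ℚ.- (ε ℚ.+ ε)            ≡⟨ solve 1 (λ ε → ε :- (ε :+ ε) := con 0ℚ :- ε) refl ε ⟩
    0ℚ ℚ.- ε                   ∎)))

-- The probability estimate for real p

≤ᵣ-1-log : ∀ x q {d} n .{{_ : NonZero n}} → 0ℚ ℚ.≤ q → (∀ k → d ℚ.≤ riemannSum n k) →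
  x ≤ᵣ 1ℝ -ᵣ fromℚ q *ᵣ log n → x ≤ᵣ fromℚ (1ℚ ℚ.- q ℚ.* d)
≤ᵣ-1-log x q n 0≤q d≤log x≤ ε 0<ε = let N , x≤′ = x≤ ε 0<ε in N , λ k k≥ →
  ℚ.≤-trans (x≤′ k k≥) (ℚ.+-monoˡ-≤ ε (ℚ.+-monoʳ-≤ 1ℚ (ℚ.neg-antimono-≤ (*-monoˡ-≤ 0≤q (d≤log k)))))

Pr-two-missing : ∀ x n N ε → 0ℝ ≤ᵣ x → x ≤ᵣ 1ℝ -ᵣ fromℚ (+ 3 / suc (suc n)) *ᵣ log (suc (suc n)) →
  2 ℕ.^ (suc N ℕ.* 2) ≤ suc (suc n) → r N ℚ.+ r N ℚ.≤ ε →
  ∀ {A : Graph (suc (suc n)) (suc (suc n)) → Set} (A? : Decidable A) →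
  (∀ G j j′ → j ≢ j′ → ¬ HasEdge G zero j → ¬ HasEdge G zero j′ → A G) →
  fromℚ (1ℚ ℚ.- ε) ≤ᵣ Pr (suc (suc n)) (suc (suc n)) x A?
Pr-two-missing x n N ε 0≤x x≤ 2^j≤n 2r≤ε A? missing⇒A =
  tracks⇒≤ᵣ (Pr m m x A?) 1-ε≤ (∑-tracks (weight x) (λ k → graphWeight (t k) (replicate m ∅))
    (weight-tracks x (clamp-tracks x 0≤1-c 0≤x x≤1-c)) (filter A? (graphs m m)))
  where
  m = suc (suc n)
  j = suc N ℕ.* 2
  d = copies j (r 1)
  q = + 3 / m
  c = q ℚ.* d
  S = alternating m

  0≤d : 0ℚ ℚ.≤ d
  0≤d = copies-nonNeg j (0≤r 1)

  0≤q : 0ℚ ℚ.≤ q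
  0≤q = ℚ.nonNegative⁻¹ q {{ℚ.normalize-nonNeg 3 m}}

  0≤c : 0ℚ ℚ.≤ c
  0≤c = 0≤p*q 0≤q 0≤d

  x≤1-c : x ≤ᵣ fromℚ (1ℚ ℚ.- c)
  x≤1-c = ≤ᵣ-1-log x q m 0≤q (λ k → riemannSum-lower j m k 2^j≤n) x≤

  0≤1-c : 0ℚ ℚ.≤ 1ℚ ℚ.- c
  0≤1-c = 0≤ᵣx≤ᵣb⇒0≤b x 0≤x x≤1-c

  t : ℕ → ℚ
  t k = clamp (1ℚ ℚ.- c) (seq x k)

  module _ (k : ℕ) where
    0≤t : 0ℚ ℚ.≤ t k
    0≤t = 0≤clamp (1ℚ ℚ.- c) (seq x k)

    t≤1-c : t k ℚ.≤ 1ℚ ℚ.- c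
    t≤1-c = clamp≤ (seq x k) 0≤1-c

    t≤1 : t k ℚ.≤ 1ℚ
    t≤1 = ℚ.≤-trans t≤1-c (0≤q-p⇒p≤q (subst (0ℚ ℚ.≤_)
      (solve 1 (λ c → c := con 1ℚ :- (con 1ℚ :- c)) refl c) 0≤c))

    full≤r : ∀ (S : Subset m) → m ≤ size S ℕ.* 3 → fullProb (t k) S ℚ.≤ r N
    full≤r S large = fullProb-upper 0≤t 0≤c (0≤r N) t≤1-c (r*copies≡1 N) S
      (d≤copies (size S) (suc n) large 0≤d)

    1-ε≤ : 1ℚ ℚ.- ε ℚ.≤ ∑ℚ (List.map (graphWeight (t k) (replicate m ∅)) (filter A? (graphs m m)))
    1-ε≤ = begin
      1ℚ ℚ.- ε
        ≤⟨ ℚ.+-monoˡ-≤ (ℚ.- ε) (two-missing-prob {t k} 0≤t t≤1 A? S missing⇒A) ⟩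
      P ℚ.+ (fullProb (t k) S ℚ.+ fullProb (t k) (∁ S)) ℚ.- ε
        ≤⟨ ℚ.+-monoˡ-≤ (ℚ.- ε) (ℚ.+-monoʳ-≤ P (ℚ.≤-trans
             (ℚ.+-mono-≤ (full≤r S (s≤s (s≤s (size-alternating n)))) (full≤r (∁ S) (s≤s (s≤s (size-∁-alternating n))))) 2r≤ε)) ⟩
      P ℚ.+ ε ℚ.- ε
        ≡⟨ solve 2 (λ P ε → P :+ ε :- ε := P) refl P ε ⟩
      P ∎
      where
      open ℚ.≤-Reasoning
      P = ∑ℚ (List.map (graphWeight (t k) (replicate m ∅)) (filter A? (graphs m m)))

-- Abstracting the event separates the probability estimate from tree covers. Only the row of vertex
-- `zero` is examined.
two-missing-whp : ∀ (p : ℕ → ℝ) {A : ∀ n → Graph n n → Set} (A? : ∀ n → Decidable (A n)) →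
  (∀ {n} (G : Graph n n) a j j′ → j ≢ j′ → ¬ HasEdge G a j → ¬ HasEdge G a j′ → A n G) →
  (∀ n → 0ℝ ≤ᵣ p n) →
  (∃[ n₀ ] ∀ n .{{_ : NonZero n}} → n₀ ≤ n → p n ≤ᵣ 1ℝ -ᵣ fromℚ (+ 3 / n) *ᵣ log n) →
  WithHighProbability p A?
two-missing-whp p A? missing⇒A 0≤p (n₀ , p≤) ε 0<ε =
  -- From `n₀` on the bound on p holds, two columns absorb the added 1 in `size-alternating`, and
  -- `L` makes the logarithm at least N + 1.
  n₀ ℕ.⊔ (2 ℕ.⊔ L) , λ n n≥ →
    let n≥′ = ℕ.m⊔n≤o⇒n≤o n₀ (2 ℕ.⊔ L) n≥ in
    large n (ℕ.m⊔n≤o⇒m≤o n₀ (2 ℕ.⊔ L) n≥) (ℕ.m⊔n≤o⇒m≤o 2 L n≥′) (ℕ.m⊔n≤o⇒n≤o 2 L n≥′)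
  where
  δ-half = half ε 0<ε
  δ = proj₁ δ-half
  r≤δ-bound = archimedean δ (proj₁ (proj₂ δ-half))
  N = proj₁ r≤δ-bound
  L = 2 ℕ.^ (suc N ℕ.* 2)

  2r≤ε : r N ℚ.+ r N ℚ.≤ ε
  2r≤ε = subst (r N ℚ.+ r N ℚ.≤_) (proj₂ (proj₂ δ-half))
    (ℚ.+-mono-≤ (proj₂ r≤δ-bound) (proj₂ r≤δ-bound))

  large : ∀ n → n₀ ≤ n → 2 ≤ n → L ≤ n →
    1ℝ -ᵣ fromℚ ε ≤ᵣ Pr n n (p n) (A? n)
  large (suc zero)    _    (s≤s ()) _
  -- The reals `1ℝ -ᵣ fromℚ ε` and `fromℚ (1ℚ ℚ.- ε)` have the same sequence, and `≤ᵣ` sees only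
  -- sequences; `η` is its tolerance.
  large (suc (suc n)) n₀≤n _ 2^j≤n η 0<η = Pr-two-missing (p (suc (suc n))) n N ε
    (0≤p (suc (suc n))) (p≤ (suc (suc n)) n₀≤n) 2^j≤n 2r≤ε
    (A? (suc (suc n))) (λ G → missing⇒A G zero) η 0<η

proposition1p2 : (p : ℕ → ℝ) →
    (∀ n → 0ℝ ≤ᵣ p n × p n ≤ᵣ 1ℝ) →
    (∃[ n₀ ] ∀ n .{{_ : NonZero n}} → n₀ ≤ n → p n ≤ᵣ 1ℝ -ᵣ fromℚ (+ 3 / n) *ᵣ log n) →
    WithHighProbability p (λ n G → 3 ≤? tc₂ G)
proposition1p2 p 0≤p≤1 p≤ = two-missing-whp p (λ n G → 3 ≤? tc₂ G)
  (λ G a b j b≢j a≁b a≁j → ¬coverable₂⇒3≤tc₂ G (¬coverable₂ G a b j (≢-sym b≢j) a≁b a≁j))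
  (λ n → proj₁ (0≤p≤1 n)) p≤
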